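{- Define a sequence $\gamma(0),\gamma(1),\gamma(2),\dots$ by $\gamma(0)=0$ and recursively $$\gamma(2^l-k)=\frac{2^l+2(-1)^l}{3}-k+2\gamma(k)\qquad (l\ge 0,\ 0\le k\le 2^{l-1}).$$ For $n\ge0$ let $P(n)$ be the $n\times n$ matrix with entries $\binom{i+j}{i}$, $0\le i,j<n$, and $\chi_n(t)=\det(tI(n)-P(n))$. Then for all $n\in\mathbf{N}$, $$\chi_n(t)\equiv (t+1)^{\gamma(n)}(t^2+t+1)^{\gamma_2(n)}\pmod 2,$$ where $\gamma_2(n)=\frac12(n-\gamma(n))$.
   Context: $I(n)$ is the $n\times n$ identity matrix; the congruence is coefficientwise in $\mathbf{Z}[t]$. -}

module Defs where

open import Algebra.Bundles using (RawRing)
import Algebra.Definitions.RawSemiring as RawSemiringDefinitions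
open import Data.Bool.Base using (if_then_else_)
open import Data.Fin.Base using (Fin; zero; suc; toℕ; punchIn)
open import Data.Fin.Properties using () renaming (_≟_ to _≟ᶠ_)
open import Data.Integer.Base using (ℤ; +_; -1ℤ; _+_; _-_; _*_; ∣_∣; _/_)
  renaming (_^_ to _^ℤ_; +-*-rawRing to ℤ-rawRing)
open import Data.Integer.Divisibility using (_∣_)
open import Data.Integer.DivMod using (_%_; a≡a%n+[a/n]*n; n%d<d)
import Data.Integer.Properties as ℤₚ
open import Data.Integer.Solver using (module +-*-Solver)
open import Data.List.Base using (List; []; _∷_; map)
open import Data.Nat.Base as ℕ using (ℕ; zero; suc)
open import Data.Nat.Combinatorics using (_C_)
import Data.Nat.Divisibility as ℕ∣
import Data.Nat.Properties as ℕₚ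
open import Data.Product.Base using (∃-syntax; _,_)
open import Data.Sum.Base using (_⊎_; inj₁; inj₂)
open import Level using (Level)
open import Relation.Binary.PropositionalEquality
open import Relation.Nullary.Decidable.Core using (does; yes; no)
open import Relation.Nullary.Negation using (contradiction)

private variable
  a ℓ : Level
  n : ℕ

-- Univariate polynomials, represented by their lists of coefficients,
-- constant term first.  Trailing zeros are allowed, so equality is
-- equality of all coefficients.

module Polynomial (R : RawRing a ℓ) where
  private module R = RawRing R

  Poly : Set _
  Poly = List R.Carrier

  coeff : Poly → ℕ → R.Carrier
  coeff []      _       = R.0#
  coeff (c ∷ p) zero    = c
  coeff (c ∷ p) (suc i) = coeff p i

  const : R.Carrier → Poly
  const c = c ∷ []

  X : Poly
  X = R.0# ∷ R.1# ∷ []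

  infixl 6 _⊕_ _⊖_
  infixl 7 _⊗_
  infix  8 ⊝_

  _⊕_ : Poly → Poly → Poly
  []      ⊕ q       = q
  (c ∷ p) ⊕ []      = c ∷ p
  (c ∷ p) ⊕ (d ∷ q) = c R.+ d ∷ (p ⊕ q)

  _⊗_ : Poly → Poly → Poly
  []      ⊗ q = []
  (c ∷ p) ⊗ q = map (c R.*_) q ⊕ (R.0# ∷ (p ⊗ q))

  ⊝_ : Poly → Poly
  ⊝_ = map R.-_

  _⊖_ : Poly → Poly → Poly
  p ⊖ q = p ⊕ ⊝ q

  rawRing : RawRing _ _
  rawRing = record
    { Carrier = Poly
    ; _≈_     = λ p q → ∀ i → coeff p i R.≈ coeff q i
    ; _+_     = _⊕_
    ; _*_     = _⊗_
    ; -_      = ⊝_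
    ; 0#      = []
    ; 1#      = const R.1#
    }

Matrix : Set a → ℕ → Set a
Matrix A n = Fin n → Fin n → A

module Determinant (R : RawRing a ℓ) where
  open RawRing R using (Carrier; 0#; 1#)
    renaming (_*_ to _*ᴿ_; -_ to -ᴿ_; rawSemiring to semiring)
  open RawSemiringDefinitions semiring using (sum) renaming (_^_ to _^ᴿ_)

  I : ∀ n → Matrix Carrier n
  I n i j = if does (i ≟ᶠ j) then 1# else 0#

  det : Matrix Carrier n → Carrier
  det {n = zero}  M = 1#
  det {n = suc n} M = sum λ (j : Fin (suc n)) →
    ((-ᴿ 1#) ^ᴿ toℕ j) *ᴿ (M zero j *ᴿ det λ i k → M (suc i) (punchIn j k))

module ℤ[t] where
  open Polynomial ℤ-rawRing public renaming (X to t)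
  open RawRing rawRing public using (1#; rawSemiring)
  open RawSemiringDefinitions rawSemiring public using (_^_)
  open Determinant rawRing public using (I; det)

infix 4 _≡_[mod_]

_≡_[mod_] : ℤ[t].Poly → ℤ[t].Poly → ℤ → Set
p ≡ q [mod m ] = ∀ i → m ∣ (ℤ[t].coeff p i - ℤ[t].coeff q i)

charPoly : Matrix ℤ n → ℤ[t].Poly
charPoly {n} M = det λ i j → t ⊗ I n i j ⊖ const (M i j)
  where open ℤ[t]

P : ∀ n → Matrix ℤ n
P n i j = + ((toℕ i ℕ.+ toℕ j) C toℕ i)

χ : ℕ → ℤ[t].Poly
χ n = charPoly (P n)

-- (2ˡ + 2(-1)ˡ)/3; the division is exact, see c-exact.
c : ℕ → ℤ
c l = ((+ 2) ^ℤ l + + 2 * -1ℤ ^ℤ l) / + 3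

-- The bound 0 ≤ k ≤ 2ˡ⁻¹ is written 2k ≤ 2ˡ, so that l = 0 allows only
-- k = 0, and ∸ never truncates.
record IsGamma (γ : ℕ → ℤ) : Set where
  field
    γ-zero : γ 0 ≡ + 0
    γ-rec  : ∀ l k → 2 ℕ.* k ℕ.≤ 2 ℕ.^ l →
             γ (2 ℕ.^ l ℕ.∸ k) ≡ c l - + k + + 2 * γ k

private
  d : ℕ → ℤ
  d zero    = + 1
  d (suc l) = (+ 2) ^ℤ l - d l

  numerator : ℕ → ℤ
  numerator l = (+ 2) ^ℤ l + + 2 * -1ℤ ^ℤ l

  d*3 : ∀ l → d l * + 3 ≡ numerator l
  d*3 zero    = refl
  d*3 (suc l) = begin
    (x - d l) * + 3               ≡⟨ lemma₁ x (d l) ⟩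
    x * + 3 - d l * + 3           ≡⟨ cong (λ z → x * + 3 - z) (d*3 l) ⟩
    x * + 3 - (x + + 2 * y)       ≡⟨ lemma₂ x y ⟩
    + 2 * x + + 2 * (-1ℤ * y)     ∎
    where
    open ≡-Reasoning
    open +-*-Solver
    x y : ℤ
    x = (+ 2) ^ℤ l
    y = -1ℤ ^ℤ l
    lemma₁ : ∀ u v → (u - v) * + 3 ≡ u * + 3 - v * + 3
    lemma₁ = solve 2 (λ u v → (u :- v) :* con (+ 3) := u :* con (+ 3) :- v :* con (+ 3)) refl
    lemma₂ : ∀ u v → u * + 3 - (u + + 2 * v) ≡ + 2 * u + + 2 * (-1ℤ * v)
    lemma₂ = solve 2 (λ u v → u :* con (+ 3) :- (u :+ con (+ 2) :* v)
      := con (+ 2) :* u :+ con (+ 2) :* (con -1ℤ :* v)) refl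

  *3/3 : ∀ x → (x * + 3) / + 3 ≡ x
  *3/3 x = sym (ℤₚ.*-cancelʳ-≡ x q (+ 3) (begin
    x * + 3          ≡⟨ eq ⟩
    + r + q * + 3    ≡⟨ cong (λ z → + z + q * + 3) r≡0 ⟩
    + 0 + q * + 3    ≡⟨ ℤₚ.+-identityˡ (q * + 3) ⟩
    q * + 3          ∎))
    where
    open ≡-Reasoning
    open +-*-Solver
    q : ℤ
    q = (x * + 3) / + 3
    r : ℕ
    r = (x * + 3) % + 3
    eq : x * + 3 ≡ + r + q * + 3
    eq = a≡a%n+[a/n]*n (x * + 3) (+ 3)
    r≡ : + r ≡ (x - q) * + 3
    r≡ = begin
      + r                          ≡⟨ lemma (+ r) q ⟩
      (+ r + q * + 3) - q * + 3    ≡⟨ cong (_- q * + 3) (sym eq) ⟩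
      x * + 3 - q * + 3            ≡⟨ lemma′ x q ⟩
      (x - q) * + 3                ∎
      where
      lemma : ∀ u v → u ≡ (u + v * + 3) - v * + 3
      lemma = solve 2 (λ u v → u := (u :+ v :* con (+ 3)) :- v :* con (+ 3)) refl
      lemma′ : ∀ u v → u * + 3 - v * + 3 ≡ (u - v) * + 3
      lemma′ = solve 2 (λ u v → u :* con (+ 3) :- v :* con (+ 3) := (u :- v) :* con (+ 3)) refl
    3∣r : 3 ℕ∣.∣ r
    3∣r = ℕ∣.divides ∣ x - q ∣ (trans (cong ∣_∣ r≡) (ℤₚ.abs-* (x - q) (+ 3)))
    r≡0 : r ≡ 0
    r≡0 with r in e | 3∣r | n%d<d (x * + 3) (+ 3)
    ... | zero  | _  | _  = refl
    ... | suc m | 3∣ | r< = contradiction 3∣ (ℕ∣.>⇒∤ r<)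

  c≡d : ∀ l → c l ≡ d l
  c≡d l = trans (cong (_/ + 3) (sym (d*3 l))) (*3/3 (d l))

c-exact : ∀ l → c l * + 3 ≡ (+ 2) ^ℤ l + + 2 * -1ℤ ^ℤ l
c-exact l = trans (cong (_* + 3) (c≡d l)) (d*3 l)

private
  pos-^ : ∀ l → + (2 ℕ.^ l) ≡ (+ 2) ^ℤ l
  pos-^ zero    = refl
  pos-^ (suc l) = trans (ℤₚ.pos-* 2 (2 ℕ.^ l)) (cong (+ 2 *_) (pos-^ l))

  c-suc : ∀ l → c (suc l) ≡ + (2 ℕ.^ l) - c l
  c-suc l = trans (c≡d (suc l)) (cong₂ _-_ (sym (pos-^ l)) (sym (c≡d l)))

  2^suc : ∀ l → 2 ℕ.^ suc l ≡ 2 ℕ.^ l ℕ.+ 2 ℕ.^ l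
  2^suc l = cong (2 ℕ.^ l ℕ.+_) (ℕₚ.+-identityʳ _)

  0<2^ : ∀ l → 0 ℕ.< 2 ℕ.^ l
  0<2^ = ℕₚ.m^n>0 2

  n≤2^n : ∀ n → n ℕ.≤ 2 ℕ.^ n
  n≤2^n zero    = ℕ.z≤n
  n≤2^n (suc n) = subst (suc n ℕ.≤_) (sym (2^suc n)) (ℕₚ.+-mono-≤ (0<2^ n) (n≤2^n n))

  -- g l agrees with γ on {0, …, 2ˡ}.
  g : ℕ → ℕ → ℤ
  g zero    zero    = + 0
  g zero    (suc _) = + 1
  g (suc l) n with n ℕₚ.≤? 2 ℕ.^ l
  ... | yes _ = g l n
  ... | no  _ = c (suc l) - + (2 ℕ.^ suc l ℕ.∸ n) + + 2 * g l (2 ℕ.^ suc l ℕ.∸ n)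

  g-low : ∀ l n → n ℕ.≤ 2 ℕ.^ l → g (suc l) n ≡ g l n
  g-low l n n≤ with n ℕₚ.≤? 2 ℕ.^ l
  ... | yes _ = refl
  ... | no ¬p = contradiction n≤ ¬p

  g-high : ∀ l n → 2 ℕ.^ l ℕ.< n → g (suc l) n ≡
           c (suc l) - + (2 ℕ.^ suc l ℕ.∸ n) + + 2 * g l (2 ℕ.^ suc l ℕ.∸ n)
  g-high l n n> with n ℕₚ.≤? 2 ℕ.^ l
  ... | yes p = contradiction p (ℕₚ.<⇒≱ n>)
  ... | no  _ = refl

  g-stable : ∀ l j n → n ℕ.≤ 2 ℕ.^ l → g (j ℕ.+ l) n ≡ g l n
  g-stable l zero    n n≤ = refl
  g-stable l (suc j) n n≤ =
    trans (g-low (j ℕ.+ l) n (ℕₚ.≤-trans n≤ (ℕₚ.^-monoʳ-≤ 2 (ℕₚ.m≤n+m l j))))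
          (g-stable l j n n≤)

  g-diagonal : ∀ l n → n ℕ.≤ 2 ℕ.^ l → g n n ≡ g l n
  g-diagonal l n n≤ = begin
    g n n            ≡⟨ sym (g-stable n l n (n≤2^n n)) ⟩
    g (l ℕ.+ n) n    ≡⟨ cong (λ m → g m n) (ℕₚ.+-comm l n) ⟩
    g (n ℕ.+ l) n    ≡⟨ g-stable l n n n≤ ⟩
    g l n            ∎
    where open ≡-Reasoning

  g-zero : ∀ l → g l 0 ≡ + 0
  g-zero zero    = refl
  g-zero (suc l) = trans (g-low l 0 ℕ.z≤n) (g-zero l)

  g-power : ∀ l → g l (2 ℕ.^ l) ≡ c l
  g-power zero    = refl
  g-power (suc l) = begin
    g (suc l) (2 ℕ.^ suc l)
      ≡⟨ g-high l _ (ℕₚ.^-monoʳ-< 2 (ℕ.s≤s (ℕ.s≤s ℕ.z≤n)) (ℕₚ.n<1+n l)) ⟩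
    c (suc l) - + k + + 2 * g l k
      ≡⟨ cong (λ m → c (suc l) - + m + + 2 * g l m) (ℕₚ.n∸n≡0 (2 ℕ.^ suc l)) ⟩
    c (suc l) - + 0 + + 2 * g l 0
      ≡⟨ cong (λ z → c (suc l) - + 0 + + 2 * z) (g-zero l) ⟩
    c (suc l) - + 0 + + 2 * + 0
      ≡⟨ solve 1 (λ u → u :- con (+ 0) :+ con (+ 2) :* con (+ 0) := u) refl (c (suc l)) ⟩
    c (suc l) ∎
    where
    open ≡-Reasoning
    open +-*-Solver
    k : ℕ
    k = 2 ℕ.^ suc l ℕ.∸ 2 ℕ.^ suc l

  g-rec : ∀ l k → 2 ℕ.* k ℕ.≤ 2 ℕ.^ l →
          g l (2 ℕ.^ l ℕ.∸ k) ≡ c l - + k + + 2 * g l k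
  g-rec zero    zero    _ = refl
  g-rec zero    (suc k) p = contradiction (ℕₚ.≤-trans (ℕₚ.*-monoʳ-≤ 2 (ℕ.s≤s ℕ.z≤n)) p) λ { (ℕ.s≤s ()) }
  g-rec (suc l) k p = by-cases (ℕₚ.m≤n⇒m<n∨m≡n k≤)
    where
    open ≡-Reasoning
    open +-*-Solver
    k≤ : k ℕ.≤ 2 ℕ.^ l
    k≤ = ℕₚ.*-cancelˡ-≤ 2 p
    by-cases : k ℕ.< 2 ℕ.^ l ⊎ k ≡ 2 ℕ.^ l →
               g (suc l) (2 ℕ.^ suc l ℕ.∸ k) ≡ c (suc l) - + k + + 2 * g (suc l) k
    by-cases (inj₁ k<) = begin
      g (suc l) m
        ≡⟨ g-high l m 2^l<m ⟩
      c (suc l) - + (2 ℕ.^ suc l ℕ.∸ m) + + 2 * g l (2 ℕ.^ suc l ℕ.∸ m)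
        ≡⟨ cong (λ i → c (suc l) - + i + + 2 * g l i) (ℕₚ.m∸[m∸n]≡n k≤2^suc) ⟩
      c (suc l) - + k + + 2 * g l k
        ≡⟨ cong (λ z → c (suc l) - + k + + 2 * z) (sym (g-low l k k≤)) ⟩
      c (suc l) - + k + + 2 * g (suc l) k ∎
      where
      m : ℕ
      m = 2 ℕ.^ suc l ℕ.∸ k
      k≤2^suc : k ℕ.≤ 2 ℕ.^ suc l
      k≤2^suc = ℕₚ.≤-trans k≤ (ℕₚ.m≤m+n _ _)
      2^l<m : 2 ℕ.^ l ℕ.< m
      2^l<m = ℕₚ.m+n≤o⇒m≤o∸n (suc (2 ℕ.^ l)) (subst (suc (2 ℕ.^ l) ℕ.+ k ℕ.≤_) (sym (2^suc l))
        (subst (ℕ._≤ 2 ℕ.^ l ℕ.+ 2 ℕ.^ l) (ℕₚ.+-suc (2 ℕ.^ l) k) (ℕₚ.+-monoʳ-≤ (2 ℕ.^ l) k<)))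
    by-cases (inj₂ refl) = begin
      g (suc l) (2 ℕ.^ suc l ℕ.∸ k)
        ≡⟨ cong (λ m → g (suc l) (m ℕ.∸ k)) (2^suc l) ⟩
      g (suc l) (k ℕ.+ k ℕ.∸ k)
        ≡⟨ cong (g (suc l)) (ℕₚ.m+n∸n≡m k k) ⟩
      g (suc l) k
        ≡⟨ g-k ⟩
      c l
        ≡⟨ solve 2 (λ u v → u := (v :- u) :- v :+ con (+ 2) :* u) refl (c l) (+ k) ⟩
      (+ k - c l) - + k + + 2 * c l
        ≡⟨ cong₂ (λ u v → u - + k + + 2 * v) (sym (c-suc l)) (sym g-k) ⟩
      c (suc l) - + k + + 2 * g (suc l) k ∎
      where
      g-k : g (suc l) k ≡ c l
      g-k = trans (g-low l k k≤) (g-power l)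

-- IsGamma is satisfiable: its clauses overlap at the powers of 2, where
-- they agree.
γ-exists : ∃[ γ ] IsGamma γ
γ-exists = (λ n → g n n) , record
  { γ-zero = refl
  ; γ-rec  = λ l k p → begin
      g (2 ℕ.^ l ℕ.∸ k) (2 ℕ.^ l ℕ.∸ k)  ≡⟨ g-diagonal l _ (ℕₚ.m∸n≤m (2 ℕ.^ l) k) ⟩
      g l (2 ℕ.^ l ℕ.∸ k)                ≡⟨ g-rec l k p ⟩
      c l - + k + + 2 * g l k            ≡⟨ cong (λ z → c l - + k + + 2 * z)
                                               (sym (g-diagonal l k (ℕₚ.≤-trans (ℕₚ.m≤m+n k _) p))) ⟩
      c l - + k + + 2 * g k k            ∎
  }
  where open ≡-Reasoning

{-# OPTIONS --safe #-}
-- Let q = 2ˡ.  Modulo 2, P(2q) has order 3, its square is P(2q) with rows and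
-- columns reversed, and its lower right q × q block vanishes.  Hence
-- (tI - P)(t²I + tP + P²) = (t³ - 1)I, and Jacobi's complementary minor
-- formula gives, for 0 ≤ k ≤ q,
--   χ_{2q-k} (t³ - 1)ᵏ ≡ χ_{2q} det(t²I - P(k)) ≡ χ_{2q} χ_k²,
-- the last step being Frobenius.  Taking k = q determines χ_{2q} from χ_q, and
-- then the other k give the recursion of γ, since t + 1 and t² + t + 1 are
-- cancellable and have product t³ - 1.
module Submission where

open import Defs
open import Algebra.Bundles using (RawRing; CommutativeRing; AbelianGroup)
import Algebra.Properties.CommutativeSemigroup as CommutativeSemigroupProperties
import Algebra.Properties.CommutativeSemiring.Exp as CommutativeSemiringExp
import Algebra.Properties.Semiring.Exp as SemiringExp
import Algebra.Properties.Semiring.Sum as SemiringSum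
import Algebra.Solver.Ring.NaturalCoefficients.Default as NaturalSolver
open import Algebra.Structures using (IsCommutativeRing; IsAbelianGroup)
open import Data.Fin.Base
  using (Fin; zero; suc; toℕ; fromℕ<; punchIn; punchOut; pinch; opposite; splitAt; _↑ˡ_; _↑ʳ_)
import Data.Fin.Properties as Finₚ
open import Data.Integer.Base as ℤ using (ℤ; +_; 0ℤ; 1ℤ)
open import Data.Integer.Divisibility using (_∣_)
import Data.Integer.Divisibility.Signed as Signed
import Data.Integer.Properties as ℤₚ
import Data.Integer.Solver as ℤSolver
open import Data.List.Base using (List; []; _∷_; map; tabulate)
open import Data.List.Properties using (map-tabulate)
open import Data.List.Relation.Binary.Permutation.Propositional as Perm using (_↭_)
open import Data.List.Relation.Binary.Permutation.Propositional.Properties using (map⁺)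
open import Data.List.Relation.Binary.Pointwise as Pointwise using (Pointwise; []; _∷_)
open import Data.Nat.Base as ℕ using (ℕ; zero; suc)
open import Data.Nat.Combinatorics using (_C_; nCk+nC[k+1]≡[n+1]C[k+1]; nCn≡1)
import Data.Nat.Properties as ℕₚ
import Data.Nat.Solver as ℕSolver
open import Data.Product.Base using (∃-syntax; ∃₂; _×_; _,_)
open import Data.Sum.Base using (_⊎_; inj₁; inj₂; [_,_]′)
open import Data.Vec.Functional using (Vector; removeAt)
open import Function.Base using (_∘_)
import Level
open import Relation.Binary.Core using (Rel)
open import Relation.Binary.PropositionalEquality as ≡ using (_≡_; _≢_)
import Relation.Binary.Reasoning.Setoid as SetoidReasoning
open import Relation.Nullary.Decidable.Core using (yes; no)
open import Relation.Nullary.Negation using (contradiction)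

-- Modulo 2 binary digits act independently (Lucas): `P(2n)` is the Kronecker product of `P(n)` with
-- the 2 × 2 block with rows (1, 1) and (1, 0). That block has order 3 over the field of two
-- elements, and its square, with rows (0, 1) and (1, 1), is the block reversed in both directions.
-- Both facts pass to Kronecker powers. The corner vanishes because its two indices share their top
-- digit, which forces a carry when they are added. Inverting `tI - P` would mean dividing by
-- `t³ - 1`. To stay with polynomials, the complementary minor formula is obtained from one matrix
-- made of columns of the identity followed by columns of `t²I + tP + P²`: this matrix and its
-- product with `tI - P` are both block triangular. The tool is thus multiplicativity of the
-- determinant, and since signs are trivial modulo 2 it is proved for the permanent. The recursion
-- subtracts exponents, so the induction has to carry two inequalities between them.

-- Finite indices, deletion of columns, and doubling.

punchIn-punchIn-pinch : ∀ {n} (j : Fin (suc (suc n))) (k : Fin (suc n)) →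
                        punchIn (punchIn j k) (pinch k j) ≡ j
punchIn-punchIn-pinch         zero    k       = ≡.refl
punchIn-punchIn-pinch         (suc j) zero    = ≡.refl
punchIn-punchIn-pinch {suc n} (suc j) (suc k) = ≡.cong suc (punchIn-punchIn-pinch j k)

-- `pinch k j` is the index that `j` acquires once column `punchIn j k` is gone, so both sides skip
-- the same two columns. This is the source of the symmetry of expansions along two rows.
punchIn-punchIn-comm : ∀ {n} (j : Fin (suc (suc n))) (k : Fin (suc n)) (x : Fin n) →
                       punchIn j (punchIn k x) ≡ punchIn (punchIn j k) (punchIn (pinch k j) x)
punchIn-punchIn-comm zero    k       x       = ≡.refl
punchIn-punchIn-comm (suc j) zero    x       = ≡.refl
punchIn-punchIn-comm (suc j) (suc k) zero    = ≡.refl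
punchIn-punchIn-comm (suc j) (suc k) (suc x) = ≡.cong suc (punchIn-punchIn-comm j k x)

tabulate-removeAt : ∀ {a} {A : Set a} {n} (f : Vector A (suc n)) j →
                    tabulate f ↭ f j ∷ tabulate (removeAt f j)
tabulate-removeAt         f zero    = Perm.refl
tabulate-removeAt {n = suc n} f (suc j) =
  Perm.trans (Perm.prep _ (tabulate-removeAt (f ∘ suc) j)) (Perm.swap _ _ Perm.refl)

punchIn-↑ˡ : ∀ {m} (j : Fin (suc m)) (l : Fin m) k → punchIn (j ↑ˡ k) (l ↑ˡ k) ≡ punchIn j l ↑ˡ k
punchIn-↑ˡ zero    l       k = ≡.refl
punchIn-↑ˡ (suc j) zero    k = ≡.refl
punchIn-↑ˡ (suc j) (suc l) k = ≡.cong suc (punchIn-↑ˡ j l k)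

punchIn-↑ʳ : ∀ {m k} (j : Fin (suc m)) (l : Fin k) → punchIn (j ↑ˡ k) (m ↑ʳ l) ≡ suc m ↑ʳ l
punchIn-↑ʳ         zero    l = ≡.refl
punchIn-↑ʳ {suc m} (suc j) l = ≡.cong suc (punchIn-↑ʳ j l)

-- Defined by recursion so that two constructors come off at each step, matching the step of
-- `pascal` and of `Fin`; `2 * n` does not reduce this way.
double : ℕ → ℕ
double zero    = zero
double (suc n) = suc (suc (double n))

double-+ : ∀ m n → double (m ℕ.+ n) ≡ double m ℕ.+ double n
double-+ zero    n = ≡.refl
double-+ (suc m) n = ≡.cong (λ k → suc (suc k)) (double-+ m n)

-- Reversing the indices below an even number exchanges parities. The bound on `i` matters: beyond
-- it the left side truncates to 0 while the right side is 1. In the odd case both sides truncate to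
-- 0, so any natural number may stand there.
double-∸-even : ∀ {n} (i : Fin n) → double n ℕ.∸ suc (double (toℕ i)) ≡ suc (double (n ℕ.∸ suc (toℕ i)))
double-∸-even zero    = ≡.refl
double-∸-even (suc i) = double-∸-even i

double-∸-odd : ∀ n i → double n ℕ.∸ suc (suc (double i)) ≡ double (n ℕ.∸ suc i)
double-∸-odd zero    i       = ≡.refl
double-∸-odd (suc n) zero    = ≡.refl
double-∸-odd (suc n) (suc i) = double-∸-odd n i

lastBit : ∀ {n} (i : Fin (double n)) →
          ∃[ h ] (toℕ i ≡ double (toℕ {n} h) ⊎ toℕ i ≡ suc (double (toℕ h)))
lastBit {suc n} zero          = zero , inj₁ ≡.refl
lastBit {suc n} (suc zero)    = zero , inj₂ ≡.refl
lastBit {suc n} (suc (suc i)) with lastBit i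
... | h , inj₁ e = suc h , inj₁ (≡.cong (λ k → suc (suc k)) e)
... | h , inj₂ e = suc h , inj₂ (≡.cong (λ k → suc (suc k)) e)

2^suc≡double : ∀ l → 2 ℕ.^ suc l ≡ double (2 ℕ.^ l)
2^suc≡double l = go (2 ℕ.^ l)
  where
  go : ∀ n → 2 ℕ.* n ≡ double n
  go zero    = ≡.refl
  go (suc n) = ≡.cong suc (≡.trans (ℕₚ.+-suc n (n ℕ.+ 0)) (≡.cong suc (go n)))

-- Permanents over a commutative ring of characteristic 2.

module Char2 {c ℓ} (R : CommutativeRing c ℓ)
  (x+x≈0 : ∀ x → CommutativeRing._≈_ R (CommutativeRing._+_ R x x) (CommutativeRing.0# R)) where

  open CommutativeRing R hiding (zero)
  open SemiringSum semiring
  open SemiringExp semiring using (_^_)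
  open SetoidReasoning setoid
  private module ≡R = ≡.≡-Reasoning
  private module S = NaturalSolver commutativeSemiring

  +≈0⇒≈ : ∀ {x y} → x + y ≈ 0# → x ≈ y
  +≈0⇒≈ {x} {y} x+y≈0 = begin
    x            ≈⟨ +-identityʳ x ⟨
    x + 0#       ≈⟨ +-congˡ (x+x≈0 y) ⟨
    x + (y + y)  ≈⟨ +-assoc x y y ⟨
    (x + y) + y  ≈⟨ +-congʳ x+y≈0 ⟩
    0# + y       ≈⟨ +-identityˡ y ⟩
    y            ∎

  +-dropʳ : ∀ x y → x + (y + y) ≈ x
  +-dropʳ x y = trans (+-congˡ (x+x≈0 y)) (+-identityʳ x)

  sum-zero : ∀ {n} {f : Vector Carrier n} → (∀ i → f i ≈ 0#) → sum f ≈ 0#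
  sum-zero {n} f≈0 = trans (sum-cong-≋ f≈0) (sum-replicate-zero n)

  -- The pairs (j , punchIn j k) run over the ordered pairs of distinct
  -- indices, and exchanging the two indices sends (j , k) to
  -- (punchIn j k , pinch k j).
  sum-symmetric : ∀ {n} (F : Fin (suc (suc n)) → Fin (suc n) → Carrier) →
                  (∀ j k → F j k ≈ F (punchIn j k) (pinch k j)) →
                  sum (λ j → sum (F j)) ≈ 0#
  sum-symmetric {n} F F-sym = begin
    x + sum (λ j → F (suc j) zero + sum (F (suc j) ∘ suc))
      ≈⟨ +-congˡ (∑-distrib-+ (λ j → F (suc j) zero) (λ j → sum (F (suc j) ∘ suc))) ⟩
    x + (sum (λ j → F (suc j) zero) + sum (λ j → sum (F (suc j) ∘ suc)))
      ≈⟨ +-congˡ (+-cong (sum-cong-≋ (λ j → F-sym (suc j) zero)) (rest n F F-sym)) ⟩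
    x + (x + 0#)
      ≈⟨ +-congˡ (+-identityʳ x) ⟩
    x + x
      ≈⟨ x+x≈0 x ⟩
    0# ∎
    where
    x = sum (F zero)
    rest : ∀ n (F : Fin (suc (suc n)) → Fin (suc n) → Carrier) →
           (∀ j k → F j k ≈ F (punchIn j k) (pinch k j)) →
           sum (λ j → sum (F (suc j) ∘ suc)) ≈ 0#
    rest zero    F F-sym = sum-zero {1} (λ _ → refl)
    rest (suc n) F F-sym = sum-symmetric (λ j k → F (suc j) (suc k)) (λ j k → F-sym (suc j) (suc k))

  -- The permanent, which is the determinant in characteristic 2.
  per : ∀ {n} → Matrix Carrier n → Carrier
  per {zero}  M = 1#
  per {suc n} M = sum λ j → M zero j * per (λ i k → M (suc i) (punchIn j k))

  infix 4 _≋_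
  _≋_ : ∀ {n} → Vector Carrier n → Vector Carrier n → Set ℓ
  x ≋ y = ∀ i → x i ≈ y i

  -- A list rather than an indexed family: permuting rows becomes `↭`, and freezing a row becomes a
  -- cons.
  Rows : ℕ → Set c
  Rows n = List (Vector Carrier n)

  removeColumn : ∀ {n} → Fin (suc n) → Rows (suc n) → Rows n
  removeColumn j = map (λ x → removeAt x j)

  -- Lists of the wrong length receive 0, which keeps linearity and alternation true without any
  -- condition on the length.
  perRows : ∀ n → Rows n → Carrier
  perRows zero    []       = 1#
  perRows zero    (_ ∷ _)  = 0#
  perRows (suc n) []       = 0#
  perRows (suc n) (x ∷ xs) = sum λ j → x j * perRows n (removeColumn j xs)

  per-rows : ∀ {n} (M : Matrix Carrier n) → per M ≈ perRows n (tabulate M)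
  per-rows {zero}  M = refl
  per-rows {suc n} M = sum-cong-≋ λ j → *-congˡ {M zero j} (trans
    (per-rows (λ i k → M (suc i) (punchIn j k)))
    (reflexive (≡.cong (perRows n) (≡.sym (map-tabulate (M ∘ suc) (λ x → removeAt x j))))))

  perRows-cong : ∀ n {xs ys} → Pointwise _≋_ xs ys → perRows n xs ≈ perRows n ys
  perRows-cong zero    []         = refl
  perRows-cong zero    (_ ∷ _)    = refl
  perRows-cong (suc n) []         = refl
  perRows-cong (suc n) (x≋ ∷ xs≋) = sum-cong-≋ λ j → *-cong (x≋ j)
    (perRows-cong n (Pointwise.map⁺ _ _ (Pointwise.map (λ y≋ → y≋ ∘ punchIn j) xs≋)))

  tabulate-≋ : ∀ {m n} {M N : Fin m → Vector Carrier n} → (∀ i → M i ≋ N i) →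
               Pointwise _≋_ (tabulate M) (tabulate N)
  tabulate-≋ = Pointwise.tabulate⁺

  per-cong : ∀ {n} {M N : Matrix Carrier n} → (∀ i → M i ≋ N i) → per M ≈ per N
  per-cong {n} {M} {N} M≋N = trans (per-rows M) (trans (perRows-cong n (tabulate-≋ M≋N)) (sym (per-rows N)))

  removeColumn₂ : ∀ {n} → Rows (suc (suc n)) → Fin (suc (suc n)) → Fin (suc n) → Carrier
  removeColumn₂ {n} xs j k = perRows n (removeColumn k (removeColumn j xs))

  removeColumn₂-sym : ∀ {n} (xs : Rows (suc (suc n))) j k →
                      removeColumn₂ xs j k ≈ removeColumn₂ xs (punchIn j k) (pinch k j)
  removeColumn₂-sym {n} xs j k = perRows-cong n (go xs)
    where
    go : ∀ xs → Pointwise _≋_ (removeColumn k (removeColumn j xs))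
                              (removeColumn (pinch k j) (removeColumn (punchIn j k) xs))
    go []       = []
    go (x ∷ xs) = (λ i → reflexive (≡.cong x (punchIn-punchIn-comm j k i))) ∷ go xs

  expansion₂ : ∀ {n} (a b : Vector Carrier (suc (suc n))) (xs : Rows (suc (suc n))) →
               Fin (suc (suc n)) → Fin (suc n) → Carrier
  expansion₂ a b xs j k = a j * (b (punchIn j k) * removeColumn₂ xs j k)

  perRows-expansion₂ : ∀ {n} a b (xs : Rows (suc (suc n))) →
                       perRows (suc (suc n)) (a ∷ b ∷ xs) ≈ sum (λ j → sum (expansion₂ a b xs j))
  perRows-expansion₂ {n} a b xs = sum-cong-≋ λ j → *-distribˡ-sum (a j) (λ k → b (punchIn j k) * removeColumn₂ xs j k)

  expansion₂-sym : ∀ {n} a b (xs : Rows (suc (suc n))) j k →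
                   expansion₂ a b xs j k ≈ expansion₂ b a xs (punchIn j k) (pinch k j)
  expansion₂-sym a b xs j k = begin
    a j * (b (punchIn j k) * removeColumn₂ xs j k)
      ≈⟨ S.solve 3 (λ u v w → u S.:* (v S.:* w) S.:= v S.:* (u S.:* w)) refl _ _ _ ⟩
    b (punchIn j k) * (a j * removeColumn₂ xs j k)
      ≈⟨ *-congˡ (*-cong (reflexive (≡.cong a (≡.sym (punchIn-punchIn-pinch j k)))) (removeColumn₂-sym xs j k)) ⟩
    expansion₂ b a xs (punchIn j k) (pinch k j) ∎

  -- Expanding along the two equal rows gives a sum over ordered pairs of distinct columns whose
  -- terms do not change when the pair is exchanged, so they cancel in twos.
  perRows-alternating : ∀ n a (xs : Rows n) → perRows n (a ∷ a ∷ xs) ≈ 0#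
  perRows-alternating zero          a xs = refl
  perRows-alternating (suc zero)    a xs = sum-zero {1} (λ i → zeroʳ (a i))
  perRows-alternating (suc (suc n)) a xs =
    trans (perRows-expansion₂ a a xs) (sum-symmetric _ (expansion₂-sym a a xs))

  -- The two expansions added together form a symmetric sum, which vanishes; in characteristic 2 a
  -- vanishing sum of two elements means that they are equal.
  perRows-swap : ∀ n a b (xs : Rows n) → perRows n (a ∷ b ∷ xs) ≈ perRows n (b ∷ a ∷ xs)
  perRows-swap zero          a b xs = refl
  perRows-swap (suc zero)    a b xs = trans (sum-zero {1} (λ i → zeroʳ (a i))) (sym (sum-zero {1} (λ i → zeroʳ (b i))))
  perRows-swap (suc (suc n)) a b xs = +≈0⇒≈ (begin
    perRows _ (a ∷ b ∷ xs) + perRows _ (b ∷ a ∷ xs)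
      ≈⟨ +-cong (perRows-expansion₂ a b xs) (perRows-expansion₂ b a xs) ⟩
    sum (λ j → sum (E a b j)) + sum (λ j → sum (E b a j))
      ≈⟨ ∑-distrib-+ (λ j → sum (E a b j)) (λ j → sum (E b a j)) ⟨
    sum (λ j → sum (E a b j) + sum (E b a j))
      ≈⟨ sum-cong-≋ (λ j → ∑-distrib-+ (E a b j) (E b a j)) ⟨
    sum (λ j → sum (λ k → E a b j k + E b a j k))
      ≈⟨ sum-symmetric (λ j k → E a b j k + E b a j k) (λ j k →
           trans (+-cong (expansion₂-sym a b xs j k) (expansion₂-sym b a xs j k)) (+-comm _ _)) ⟩
    0# ∎)
    where
    E = λ a b → expansion₂ a b xs

  perRows-↭ : ∀ n {xs ys} → xs ↭ ys → perRows n xs ≈ perRows n ys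
  perRows-↭ n             Perm.refl         = refl
  perRows-↭ n             (Perm.trans p q)  = trans (perRows-↭ n p) (perRows-↭ n q)
  perRows-↭ zero          (Perm.prep x p)   = refl
  perRows-↭ zero          (Perm.swap x y p) = refl
  perRows-↭ (suc n)       (Perm.prep x p)   = sum-cong-≋ λ j → *-congˡ {x j} (perRows-↭ n (map⁺ (λ z → removeAt z j) p))
  perRows-↭ (suc n)       (Perm.swap {xs} x y p) = trans (perRows-swap (suc n) x y xs)
    (sum-cong-≋ λ j → *-congˡ {y j} (perRows-↭ n (Perm.prep (removeAt x j) (map⁺ (λ z → removeAt z j) p))))

  -- Alternating forms and multiplicativity of the permanent.

  _·ᵥ_ : ∀ {n} → Carrier → Vector Carrier n → Vector Carrier n
  (a ·ᵥ x) i = a * x i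

  _+ᵥ_ : ∀ {n} → Vector Carrier n → Vector Carrier n → Vector Carrier n
  (x +ᵥ y) i = x i + y i

  combination : ∀ {m n} → Vector Carrier m → (Fin m → Vector Carrier n) → Vector Carrier n
  combination a x k = sum λ i → a i * x i k

  -- The notion is closed under freezing a first row (`prepend`), which the induction in
  -- `f-combinations` requires and which `perRows` alone would not offer. Invariance under `↭`
  -- carries no sign because -1 = 1.
  record AlternatingForm {n} (f : Rows n → Carrier) : Set (c Level.⊔ ℓ) where
    field
      f-cong        : ∀ {xs ys} → Pointwise _≋_ xs ys → f xs ≈ f ys
      f-↭           : ∀ {xs ys} → xs ↭ ys → f xs ≈ f ys
      f-additive    : ∀ x y xs → f ((x +ᵥ y) ∷ xs) ≈ f (x ∷ xs) + f (y ∷ xs)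
      f-scale       : ∀ a x xs → f ((a ·ᵥ x) ∷ xs) ≈ a * f (x ∷ xs)
      f-alternating : ∀ x xs → f (x ∷ x ∷ xs) ≈ 0#

    f-combination : ∀ {m} (a : Vector Carrier m) (x : Fin m → Vector Carrier n) xs →
                    f (combination a x ∷ xs) ≈ sum (λ i → a i * f (x i ∷ xs))
    f-combination {zero} a x xs = begin
      f (combination a x ∷ xs)   ≈⟨ f-cong ((λ _ → sym (zeroˡ 0#)) ∷ Pointwise.refl (λ _ → refl)) ⟩
      f ((0# ·ᵥ λ _ → 0#) ∷ xs)  ≈⟨ f-scale 0# _ xs ⟩
      0# * f ((λ _ → 0#) ∷ xs)   ≈⟨ zeroˡ _ ⟩
      0#                         ∎
    f-combination {suc m} a x xs = begin
      f (((a zero ·ᵥ x zero) +ᵥ combination (a ∘ suc) (x ∘ suc)) ∷ xs)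
        ≈⟨ f-additive _ _ xs ⟩
      f ((a zero ·ᵥ x zero) ∷ xs) + f (combination (a ∘ suc) (x ∘ suc) ∷ xs)
        ≈⟨ +-cong (f-scale _ _ xs) (f-combination (a ∘ suc) (x ∘ suc) xs) ⟩
      sum (λ i → a i * f (x i ∷ xs)) ∎

  prepend : ∀ {n} {f : Rows n → Carrier} → AlternatingForm f → ∀ x → AlternatingForm (f ∘ (x ∷_))
  prepend {f = f} alt x = record
    { f-cong        = λ xs≋ → f-cong ((λ _ → refl) ∷ xs≋)
    ; f-↭           = λ p → f-↭ (Perm.prep x p)
    ; f-additive    = λ y z xs → begin
        f (x ∷ (y +ᵥ z) ∷ xs)              ≈⟨ swap x (y +ᵥ z) xs ⟩
        f ((y +ᵥ z) ∷ x ∷ xs)              ≈⟨ f-additive y z (x ∷ xs) ⟩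
        f (y ∷ x ∷ xs) + f (z ∷ x ∷ xs)    ≈⟨ +-cong (swap y x xs) (swap z x xs) ⟩
        f (x ∷ y ∷ xs) + f (x ∷ z ∷ xs)    ∎
    ; f-scale       = λ a y xs → begin
        f (x ∷ (a ·ᵥ y) ∷ xs)  ≈⟨ swap x (a ·ᵥ y) xs ⟩
        f ((a ·ᵥ y) ∷ x ∷ xs)  ≈⟨ f-scale a y (x ∷ xs) ⟩
        a * f (y ∷ x ∷ xs)     ≈⟨ *-congˡ (swap y x xs) ⟩
        a * f (x ∷ y ∷ xs)     ∎
    ; f-alternating = λ y xs → begin
        f (x ∷ y ∷ y ∷ xs)  ≈⟨ swap x y (y ∷ xs) ⟩
        f (y ∷ x ∷ y ∷ xs)  ≈⟨ f-↭ (Perm.prep y (Perm.swap x y Perm.refl)) ⟩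
        f (y ∷ y ∷ x ∷ xs)  ≈⟨ f-alternating y (x ∷ xs) ⟩
        0#                  ∎
    }
    where
    open AlternatingForm alt
    swap : ∀ y z xs → f (y ∷ z ∷ xs) ≈ f (z ∷ y ∷ xs)
    swap y z xs = f-↭ (Perm.swap y z Perm.refl)

  f-addMultiples : ∀ {m n} {f : Rows n → Carrier} → AlternatingForm f →
                   ∀ x (a : Vector Carrier m) (y : Fin m → Vector Carrier n) →
                   f (x ∷ tabulate (λ i → (a i ·ᵥ x) +ᵥ y i)) ≈ f (x ∷ tabulate y)
  f-addMultiples {zero}  alt x a y = refl
  f-addMultiples {suc m} {f = f} alt x a y = begin
    f (x ∷ ((a zero ·ᵥ x) +ᵥ y zero) ∷ zs)
      ≈⟨ X.f-additive _ _ zs ⟩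
    f (x ∷ (a zero ·ᵥ x) ∷ zs) + f (x ∷ y zero ∷ zs)
      ≈⟨ +-congʳ (X.f-scale _ _ zs) ⟩
    a zero * f (x ∷ x ∷ zs) + f (x ∷ y zero ∷ zs)
      ≈⟨ +-congʳ (trans (*-congˡ (f-alternating x zs)) (zeroʳ _)) ⟩
    0# + f (x ∷ y zero ∷ zs)
      ≈⟨ +-identityˡ _ ⟩
    f (x ∷ y zero ∷ zs)
      ≈⟨ f-↭ (Perm.swap x (y zero) Perm.refl) ⟩
    f (y zero ∷ x ∷ zs)
      ≈⟨ f-addMultiples (prepend alt (y zero)) x (a ∘ suc) (y ∘ suc) ⟩
    f (y zero ∷ x ∷ tabulate (y ∘ suc))
      ≈⟨ f-↭ (Perm.swap (y zero) x Perm.refl) ⟩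
    f (x ∷ tabulate y) ∎
    where
    open AlternatingForm alt
    module X = AlternatingForm (prepend alt x)
    zs = tabulate (λ i → (a (suc i) ·ᵥ x) +ᵥ y (suc i))

  -- Expanding the first row puts `x j` in front. Multiples of `x j` can then be dropped from the
  -- other rows, which leaves the same problem for the form with `x j` prepended and the minor that
  -- omits column `j`. The coefficients assemble into the first-row expansion of `per M`. Applied to
  -- `perRows n` and the rows of a second matrix, this is multiplicativity.
  f-combinations : ∀ {m n} {f : Rows n → Carrier} → AlternatingForm f →
                   (M : Matrix Carrier m) (x : Fin m → Vector Carrier n) →
                   f (tabulate (λ i → combination (M i) x)) ≈ per M * f (tabulate x)
  f-combinations {zero}  {f = f} alt M x = sym (*-identityˡ _)
  f-combinations {suc m} {f = f} alt M x = begin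
    f (combination (M zero) x ∷ rows)
      ≈⟨ f-combination (M zero) x rows ⟩
    sum (λ j → M zero j * f (x j ∷ rows))
      ≈⟨ sum-cong-≋ (λ j → *-congˡ {M zero j} (column j)) ⟩
    sum (λ j → M zero j * (minor j * f (tabulate x)))
      ≈⟨ sum-cong-≋ (λ j → *-assoc (M zero j) (minor j) (f (tabulate x))) ⟨
    sum (λ j → (M zero j * minor j) * f (tabulate x))
      ≈⟨ *-distribʳ-sum (f (tabulate x)) (λ j → M zero j * minor j) ⟨
    per M * f (tabulate x) ∎
    where
    open AlternatingForm alt
    rows = tabulate (λ i → combination (M (suc i)) x)
    minor : Fin (suc m) → Carrier
    minor j = per (λ i k → M (suc i) (punchIn j k))
    column : ∀ j → f (x j ∷ rows) ≈ minor j * f (tabulate x)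
    column j = begin
      f (x j ∷ rows)
        ≈⟨ f-cong ((λ _ → refl) ∷ tabulate-≋ (λ i k → sum-remove {i = j} (λ l → M (suc i) l * x l k))) ⟩
      f (x j ∷ tabulate (λ i → (M (suc i) j ·ᵥ x j) +ᵥ combination (removeAt (M (suc i)) j) (removeAt x j)))
        ≈⟨ f-addMultiples alt (x j) (λ i → M (suc i) j) _ ⟩
      f (x j ∷ tabulate (λ i → combination (removeAt (M (suc i)) j) (removeAt x j)))
        ≈⟨ f-combinations (prepend alt (x j)) _ (removeAt x j) ⟩
      minor j * f (x j ∷ tabulate (removeAt x j))
        ≈⟨ *-congˡ (f-↭ (tabulate-removeAt x j)) ⟨
      minor j * f (tabulate x) ∎

  perRows-form : ∀ n → AlternatingForm (perRows n)
  perRows-form n = record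
    { f-cong        = perRows-cong n
    ; f-↭           = perRows-↭ n
    ; f-additive    = additive n
    ; f-scale       = scale n
    ; f-alternating = perRows-alternating n
    }
    where
    additive : ∀ n x y xs → perRows n ((x +ᵥ y) ∷ xs) ≈ perRows n (x ∷ xs) + perRows n (y ∷ xs)
    additive zero    x y xs = sym (+-identityˡ 0#)
    additive (suc n) x y xs = trans (sum-cong-≋ λ j → distribʳ (perRows n (removeColumn j xs)) (x j) (y j))
      (∑-distrib-+ (λ j → x j * perRows n (removeColumn j xs)) (λ j → y j * perRows n (removeColumn j xs)))
    scale : ∀ n a x xs → perRows n ((a ·ᵥ x) ∷ xs) ≈ a * perRows n (x ∷ xs)
    scale zero    a x xs = sym (zeroʳ a)
    scale (suc n) a x xs = trans (sum-cong-≋ λ j → *-assoc a (x j) (perRows n (removeColumn j xs)))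
      (sym (*-distribˡ-sum a (λ j → x j * perRows n (removeColumn j xs))))

  infixl 7 _·_
  _·_ : ∀ {n} → Matrix Carrier n → Matrix Carrier n → Matrix Carrier n
  (M · N) i = combination (M i) N

  per-· : ∀ {n} (M N : Matrix Carrier n) → per (M · N) ≈ per M * per N
  per-· {n} M N = begin
    per (M · N)                     ≈⟨ per-rows (M · N) ⟩
    perRows n (tabulate (M · N))    ≈⟨ f-combinations (perRows-form n) M N ⟩
    per M * perRows n (tabulate N)  ≈⟨ *-congˡ (per-rows N) ⟨
    per M * per N                   ∎

  -- Block triangular matrices, reversal and squaring.

  per-zeroColumn : ∀ {n} (M : Matrix Carrier n) k → (∀ i → M i k ≈ 0#) → per M ≈ 0#
  per-zeroColumn {suc n} M k M≈0 = sum-zero term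
    where
    term : ∀ j → M zero j * per (λ i l → M (suc i) (punchIn j l)) ≈ 0#
    term j with j Finₚ.≟ k
    ... | yes ≡.refl = trans (*-congʳ (M≈0 zero)) (zeroˡ _)
    ... | no  j≢k    = trans (*-congˡ (per-zeroColumn _ (punchOut j≢k) λ i →
      trans (reflexive (≡.cong (M (suc i)) (Finₚ.punchIn-punchOut j≢k))) (M≈0 (suc i)))) (zeroʳ _)

  sum-++ : ∀ m {k} (f : Vector Carrier (m ℕ.+ k)) →
           sum f ≈ sum (λ i → f (i ↑ˡ k)) + sum (λ i → f (m ↑ʳ i))
  sum-++ zero    f = sym (+-identityˡ _)
  sum-++ (suc m) f = trans (+-congˡ (sum-++ m (f ∘ suc))) (sym (+-assoc _ _ _))

  per-blockLower : ∀ m {k} (M : Matrix Carrier (m ℕ.+ k)) →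
                   (∀ i j → M (i ↑ˡ k) (m ↑ʳ j) ≈ 0#) →
                   per M ≈ per (λ i j → M (i ↑ˡ k) (j ↑ˡ k)) * per (λ i j → M (m ↑ʳ i) (m ↑ʳ j))
  per-blockLower zero    M M≈0 = sym (*-identityˡ _)
  per-blockLower (suc m) {k} M M≈0 = begin
    per M
      ≈⟨ sum-++ (suc m) term ⟩
    sum (λ j → term (j ↑ˡ k)) + sum (λ j → term (suc m ↑ʳ j))
      ≈⟨ +-cong (sum-cong-≋ left) (sum-zero λ j → trans (*-congʳ (M≈0 zero j)) (zeroˡ (minor (suc m ↑ʳ j)))) ⟩
    sum (λ j → (M zero (j ↑ˡ k) * minorA j) * per D) + 0#
      ≈⟨ +-identityʳ _ ⟩
    sum (λ j → (M zero (j ↑ˡ k) * minorA j) * per D)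
      ≈⟨ *-distribʳ-sum (per D) (λ j → M zero (j ↑ˡ k) * minorA j) ⟨
    per A * per D ∎
    where
    A = λ i j → M (i ↑ˡ k) (j ↑ˡ k)
    D = λ i j → M (suc m ↑ʳ i) (suc m ↑ʳ j)
    minor : Fin (suc m ℕ.+ k) → Carrier
    minor j = per (λ i l → M (suc i) (punchIn j l))
    minorA : Fin (suc m) → Carrier
    minorA j = per (λ i l → A (suc i) (punchIn j l))
    term : Fin (suc m ℕ.+ k) → Carrier
    term j = M zero j * minor j
    left : ∀ j → term (j ↑ˡ k) ≈ (M zero (j ↑ˡ k) * minorA j) * per D
    left j = trans (*-congˡ (begin
      minor (j ↑ˡ k)
        ≈⟨ per-blockLower m _ (λ i l →
             trans (reflexive (≡.cong (M (suc (i ↑ˡ k))) (punchIn-↑ʳ j l))) (M≈0 (suc i) l)) ⟩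
      per (λ i l → M (suc (i ↑ˡ k)) (punchIn (j ↑ˡ k) (l ↑ˡ k))) *
      per (λ i l → M (suc m ↑ʳ i) (punchIn (j ↑ˡ k) (m ↑ʳ l)))
        ≈⟨ *-cong (per-cong λ i l → reflexive (≡.cong (M (suc (i ↑ˡ k))) (punchIn-↑ˡ j l k)))
                  (per-cong λ i l → reflexive (≡.cong (M (suc m ↑ʳ i)) (punchIn-↑ʳ j l))) ⟩
      minorA j * per D ∎)) (sym (*-assoc _ _ _))

  δ : ℕ → ℕ → Carrier
  δ zero    zero    = 1#
  δ zero    (suc _) = 0#
  δ (suc _) zero    = 0#
  δ (suc i) (suc j) = δ i j

  δ-diagonal : ∀ i → δ i i ≡ 1#
  δ-diagonal zero    = ≡.refl
  δ-diagonal (suc i) = δ-diagonal i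

  δ-offDiagonal : ∀ {i j} → i ≢ j → δ i j ≡ 0#
  δ-offDiagonal {zero}  {zero}  i≢j = contradiction ≡.refl i≢j
  δ-offDiagonal {zero}  {suc j} i≢j = ≡.refl
  δ-offDiagonal {suc i} {zero}  i≢j = ≡.refl
  δ-offDiagonal {suc i} {suc j} i≢j = δ-offDiagonal (i≢j ∘ ≡.cong suc)

  δ-+ : ∀ m i j → δ (m ℕ.+ i) (m ℕ.+ j) ≡ δ i j
  δ-+ zero    i j = ≡.refl
  δ-+ (suc m) i j = δ-+ m i j

  δ-opposite : ∀ {n} (i j : Fin n) → δ (toℕ (opposite i)) (toℕ (opposite j)) ≡ δ (toℕ i) (toℕ j)
  δ-opposite i j with i Finₚ.≟ j
  ... | yes ≡.refl = ≡.trans (δ-diagonal (toℕ (opposite i))) (≡.sym (δ-diagonal (toℕ i)))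
  ... | no  i≢j    = ≡.trans (δ-offDiagonal (i≢j ∘ opposite-injective ∘ Finₚ.toℕ-injective))
                             (≡.sym (δ-offDiagonal (i≢j ∘ Finₚ.toℕ-injective)))
    where
    opposite-injective : opposite i ≡ opposite j → i ≡ j
    opposite-injective e =
      ≡.trans (≡.sym (Finₚ.opposite-involutive i)) (≡.trans (≡.cong opposite e) (Finₚ.opposite-involutive j))

  δ-idem : ∀ i j → δ i j * δ i j ≈ δ i j
  δ-idem zero    zero    = *-identityˡ 1#
  δ-idem zero    (suc j) = zeroˡ 0#
  δ-idem (suc i) zero    = zeroˡ 0#
  δ-idem (suc i) (suc j) = δ-idem i j

  sum-δˡ : ∀ {n} (i : Fin n) (f : Vector Carrier n) → sum (λ k → δ (toℕ i) (toℕ k) * f k) ≈ f i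
  sum-δˡ zero    f = trans (+-cong (*-identityˡ _) (sum-zero λ k → zeroˡ (f (suc k)))) (+-identityʳ _)
  sum-δˡ (suc i) f = trans (+-cong (zeroˡ _) (sum-δˡ i (f ∘ suc))) (+-identityˡ _)

  sum-δʳ : ∀ {n} (i : Fin n) (f : Vector Carrier n) → sum (λ k → f k * δ (toℕ k) (toℕ i)) ≈ f i
  sum-δʳ zero    f = trans (+-cong (*-identityʳ _) (sum-zero λ k → zeroʳ (f (suc k)))) (+-identityʳ _)
  sum-δʳ (suc i) f = trans (+-cong (zeroʳ _) (sum-δʳ i (f ∘ suc))) (+-identityˡ _)

  -- Matrices are cut out of an infinite array, so that leading minors of all sizes share their
  -- entries and a trailing block is only a shift of indices.
  ⟦_⟧ : (ℕ → ℕ → Carrier) → ∀ n → Matrix Carrier n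
  ⟦ F ⟧ n i j = F (toℕ i) (toℕ j)

  per-scalar : ∀ s n → per (⟦ (λ i j → s * δ i j) ⟧ n) ≈ s ^ n
  per-scalar s zero    = refl
  per-scalar s (suc n) = begin
    (s * 1#) * per (⟦ (λ i j → s * δ i j) ⟧ n) + sum {n} _
      ≈⟨ +-cong (*-cong (*-identityʳ s) (per-scalar s n))
                (sum-zero {n} λ j → trans (*-congʳ (zeroʳ s)) (zeroˡ _)) ⟩
    s * s ^ n + 0#
      ≈⟨ +-identityʳ _ ⟩
    s * s ^ n ∎

  per-identity : ∀ n → per (⟦ δ ⟧ n) ≈ 1#
  per-identity n = trans (per-cong {n} λ i j → sym (*-identityˡ (δ (toℕ i) (toℕ j)))) (trans (per-scalar 1# n) (1^n≈1 n))
    where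
    1^n≈1 : ∀ n → 1# ^ n ≈ 1#
    1^n≈1 zero    = refl
    1^n≈1 (suc n) = trans (*-identityˡ _) (1^n≈1 n)

  -- Expansion runs along the first row, whereas the zeros are in the first column. Every minor
  -- other than the first one keeps that column, whose entries below the first row are 0, and so it
  -- vanishes.
  per-blockUpper : ∀ m {k} (M : Matrix Carrier (m ℕ.+ k)) →
                   (∀ i j → M (i ↑ˡ k) (j ↑ˡ k) ≈ δ (toℕ i) (toℕ j)) →
                   (∀ i j → M (m ↑ʳ i) (j ↑ˡ k) ≈ 0#) →
                   per M ≈ per (λ i j → M (m ↑ʳ i) (m ↑ʳ j))
  per-blockUpper zero    M M≈δ M≈0 = refl
  per-blockUpper (suc m) {k} M M≈δ M≈0 = begin
    M zero zero * per (λ i j → M (suc i) (suc j)) + sum (λ j → M zero (suc j) * minor j)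
      ≈⟨ +-cong (*-cong (M≈δ zero zero)
                  (per-blockUpper m _ (λ i j → M≈δ (suc i) (suc j)) (λ i j → M≈0 i (suc j))))
                (sum-zero λ j → trans (*-congˡ (minor≈0 j)) (zeroʳ (M zero (suc j)))) ⟩
    1# * per (λ i j → M (suc m ↑ʳ i) (suc m ↑ʳ j)) + 0#
      ≈⟨ trans (+-identityʳ _) (*-identityˡ _) ⟩
    per (λ i j → M (suc m ↑ʳ i) (suc m ↑ʳ j)) ∎
    where
    minor : Fin (m ℕ.+ k) → Carrier
    minor j = per (λ i l → M (suc i) (punchIn (suc j) l))
    column≈0 : ∀ i → M (suc i) zero ≈ 0#
    column≈0 i with splitAt m i | Finₚ.join-splitAt m k i
    ... | inj₁ i′ | e = trans (reflexive (≡.cong (λ i → M (suc i) zero) (≡.sym e))) (M≈δ (suc i′) zero)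
    ... | inj₂ i′ | e = trans (reflexive (≡.cong (λ i → M (suc i) zero) (≡.sym e))) (M≈0 i′ zero)
    minor≈0 : ∀ j → minor j ≈ 0#
    minor≈0 j = per-zeroColumn _ (punchOut j≢0) λ i →
      trans (reflexive (≡.cong (M (suc i)) (Finₚ.punchIn-punchOut j≢0))) (column≈0 i)
      where
      j≢0 : suc j ≢ zero
      j≢0 ()

  -- Conjugation by the reversal matrix. It is written in two forms, so that multiplying from either
  -- side collapses a sum against `δ`. Its own permanent is never computed: the two factors multiply
  -- to the permanent of the identity.
  per-opposite : ∀ {n} (M : Matrix Carrier n) → per (λ i j → M (opposite i) (opposite j)) ≈ per M
  per-opposite {n} M = begin
    per (λ i j → M (opposite i) (opposite j))
      ≈⟨ per-cong (λ i j → trans (sum-δʳ (opposite j) ((Jˡ · M) i)) (sum-δˡ (opposite i) (λ k → M k (opposite j)))) ⟨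
    per ((Jˡ · M) · Jʳ)
      ≈⟨ trans (per-· (Jˡ · M) Jʳ) (*-congʳ (per-· Jˡ M)) ⟩
    (per Jˡ * per M) * per Jʳ
      ≈⟨ S.solve 3 (λ x y z → (x S.:* y) S.:* z S.:= (x S.:* z) S.:* y) refl _ _ _ ⟩
    (per Jˡ * per Jʳ) * per M
      ≈⟨ *-congʳ (begin
        per Jˡ * per Jʳ  ≈⟨ per-· Jˡ Jʳ ⟨
        per (Jˡ · Jʳ)    ≈⟨ per-cong (λ i j → trans (sum-δˡ (opposite i) (λ k → Jʳ k j)) (reflexive (δ-opposite i j))) ⟩
        per (⟦ δ ⟧ n)    ≈⟨ per-identity n ⟩
        1#               ∎) ⟩
    1# * per M
      ≈⟨ *-identityˡ _ ⟩
    per M ∎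
    where
    Jˡ Jʳ : Matrix Carrier n
    Jˡ i j = δ (toℕ (opposite i)) (toℕ j)
    Jʳ i j = δ (toℕ i) (toℕ (opposite j))

  +-square : ∀ x y → (x + y) * (x + y) ≈ x * x + y * y
  +-square x y = begin
    (x + y) * (x + y)
      ≈⟨ S.solve 2 (λ x y → (x S.:+ y) S.:* (x S.:+ y) S.:=
           (x S.:* x S.:+ y S.:* y) S.:+ (x S.:* y S.:+ x S.:* y)) refl x y ⟩
    (x * x + y * y) + (x * y + x * y)
      ≈⟨ +-dropʳ _ _ ⟩
    x * x + y * y ∎

  *-square : ∀ x y → (x * y) * (x * y) ≈ (x * x) * (y * y)
  *-square = S.solve 2 (λ x y → (x S.:* y) S.:* (x S.:* y) S.:= (x S.:* x) S.:* (y S.:* y)) refl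

  sum-square : ∀ {n} (f : Vector Carrier n) → sum f * sum f ≈ sum (λ i → f i * f i)
  sum-square {zero}  f = zeroˡ 0#
  sum-square {suc n} f = trans (+-square _ _) (+-congˡ (sum-square (f ∘ suc)))

  per-square : ∀ {n} (M : Matrix Carrier n) → per (λ i j → M i j * M i j) ≈ per M * per M
  per-square {zero}  M = sym (*-identityˡ 1#)
  per-square {suc n} M = begin
    sum (λ j → (M zero j * M zero j) * per (λ i l → M (suc i) (punchIn j l) * M (suc i) (punchIn j l)))
      ≈⟨ sum-cong-≋ (λ j → trans (*-congˡ {M zero j * M zero j} (per-square (λ i l → M (suc i) (punchIn j l))))
                                 (sym (*-square (M zero j) (minor j)))) ⟩
    sum (λ j → (M zero j * minor j) * (M zero j * minor j))
      ≈⟨ sum-square (λ j → M zero j * minor j) ⟨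
    per M * per M ∎
    where
    minor : Fin (suc n) → Carrier
    minor j = per (λ i l → M (suc i) (punchIn j l))

  -- Pascal’s triangle in characteristic 2

  pascal : ℕ → ℕ → Carrier
  pascal zero    j       = 1#
  pascal (suc i) zero    = 1#
  pascal (suc i) (suc j) = pascal i (suc j) + pascal (suc i) j

  pascal-zeroʳ : ∀ i → pascal i zero ≡ 1#
  pascal-zeroʳ zero    = ≡.refl
  pascal-zeroʳ (suc i) = ≡.refl

  -- Squaring is additive in characteristic 2, so idempotents are preserved by the recurrence. As a
  -- consequence, squaring the entries of `T` changes only `t` into `t * t`.
  pascal-idem : ∀ i j → pascal i j * pascal i j ≈ pascal i j
  pascal-idem zero    j       = *-identityˡ 1#
  pascal-idem (suc i) zero    = *-identityˡ 1#
  pascal-idem (suc i) (suc j) = trans (+-square _ _) (+-cong (pascal-idem i (suc j)) (pascal-idem (suc i) j))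

  -- Lucas' theorem for the last binary digit. The recurrence passes between parities, so the four
  -- cases are proved together; in the odd-odd case it adds two equal entries.
  pascal-even-even : ∀ i j → pascal (double i) (double j) ≈ pascal i j
  pascal-even-odd  : ∀ i j → pascal (double i) (suc (double j)) ≈ pascal i j
  pascal-odd-even  : ∀ i j → pascal (suc (double i)) (double j) ≈ pascal i j
  pascal-odd-odd   : ∀ i j → pascal (suc (double i)) (suc (double j)) ≈ 0#

  pascal-even-even zero    j       = refl
  pascal-even-even (suc i) zero    = refl
  pascal-even-even (suc i) (suc j) = +-cong (pascal-odd-even i (suc j)) (pascal-even-odd (suc i) j)

  pascal-even-odd zero    j = refl
  pascal-even-odd (suc i) j = trans (+-cong (pascal-odd-odd i j) (pascal-even-even (suc i) j)) (+-identityˡ _)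

  pascal-odd-even i zero    = reflexive (≡.sym (pascal-zeroʳ i))
  pascal-odd-even i (suc j) = trans (+-cong (pascal-even-even i (suc j)) (pascal-odd-odd i j)) (+-identityʳ _)

  pascal-odd-odd i j = trans (+-cong (pascal-even-odd i j) (pascal-odd-even i j)) (x+x≈0 _)

  reflected : ℕ → ℕ → ℕ → Carrier
  reflected n i j = pascal (n ℕ.∸ suc i) (n ℕ.∸ suc j)

  -- Reversal exchanges the parities, so the 2 × 2 block with rows (1, 1) and (1, 0) that governs
  -- `pascal` turns into the one with rows (0, 1) and (1, 1), which is both its square and its
  -- inverse modulo 2.
  reflected-even-even : ∀ {n} (i j : Fin n) → reflected (double n) (double (toℕ i)) (double (toℕ j)) ≈ 0#
  reflected-even-even {n} i j = trans (reflexive 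
      (≡.cong₂ pascal (double-∸-even i) (double-∸-even j))) (pascal-odd-odd (n ℕ.∸ suc (toℕ i)) (n ℕ.∸ suc (toℕ j)))

  reflected-even-odd : ∀ {n} (i : Fin n) j → reflected (double n) (double (toℕ i)) (suc (double j)) ≈ reflected n (toℕ i) j
  reflected-even-odd {n} i j = trans (reflexive 
      (≡.cong₂ pascal (double-∸-even i) (double-∸-odd n j))) (pascal-odd-even (n ℕ.∸ suc (toℕ i)) (n ℕ.∸ suc j))

  reflected-odd-even : ∀ {n} i (j : Fin n) → reflected (double n) (suc (double i)) (double (toℕ j)) ≈ reflected n i (toℕ j)
  reflected-odd-even {n} i j = trans (reflexive 
      (≡.cong₂ pascal (double-∸-odd n i) (double-∸-even j))) (pascal-even-odd (n ℕ.∸ suc i) (n ℕ.∸ suc (toℕ j)))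

  reflected-odd-odd : ∀ n i j → reflected (double n) (suc (double i)) (suc (double j)) ≈ reflected n i j
  reflected-odd-odd n i j = trans (reflexive 
      (≡.cong₂ pascal (double-∸-odd n i) (double-∸-odd n j))) (pascal-even-even (n ℕ.∸ suc i) (n ℕ.∸ suc j))

  δ-even-even : ∀ i j → δ (double i) (double j) ≡ δ i j
  δ-even-even zero    zero    = ≡.refl
  δ-even-even zero    (suc j) = ≡.refl
  δ-even-even (suc i) zero    = ≡.refl
  δ-even-even (suc i) (suc j) = δ-even-even i j

  δ-even-odd : ∀ i j → δ (double i) (suc (double j)) ≡ 0#
  δ-even-odd zero    j       = ≡.refl
  δ-even-odd (suc i) zero    = ≡.refl
  δ-even-odd (suc i) (suc j) = δ-even-odd i j

  δ-odd-even : ∀ i j → δ (suc (double i)) (double j) ≡ 0#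
  δ-odd-even i       zero    = ≡.refl
  δ-odd-even zero    (suc j) = ≡.refl
  δ-odd-even (suc i) (suc j) = δ-odd-even i j

  sum-double : ∀ n (F : ℕ → Carrier) {g : Vector Carrier n} →
               (∀ k → F (double (toℕ k)) + F (suc (double (toℕ k))) ≈ g k) →
               sum (λ (k : Fin (double n)) → F (toℕ k)) ≈ sum g
  sum-double zero    F F≈g = refl
  sum-double (suc n) F F≈g = trans (sym (+-assoc _ _ _))
    (+-cong (F≈g zero) (sum-double n (λ k → F (suc (suc k))) (λ k → F≈g (suc k))))

  record ReflectedCube (n : ℕ) : Set ℓ where
    field
      pascal² : ∀ (i j : Fin n) → sum (λ (k : Fin n) → pascal (toℕ i) (toℕ k) * pascal (toℕ k) (toℕ j)) ≈
                reflected n (toℕ i) (toℕ j)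
      pascal³ : ∀ (i j : Fin n) → sum (λ (k : Fin n) → pascal (toℕ i) (toℕ k) * reflected n (toℕ k) (toℕ j)) ≈
                δ (toℕ i) (toℕ j)

  -- Both equations are compatible with Kronecker products and hold for the 2 × 2 blocks. Each case
  -- below is one entry of a product of such blocks: `cancel` is an entry 1 + 1, and the other
  -- helpers discard a term with a factor 0.
  reflectedCube-double : ∀ {n} → ReflectedCube n → ReflectedCube (double n)
  reflectedCube-double {n} r = record { pascal² = square ; pascal³ = cube }
    where
    open ReflectedCube r
    +*0 : ∀ {x y u} → u ≈ x → y ≈ 0# → ∀ z → u + z * y ≈ x
    +*0 u≈x y≈0 z = trans (+-cong u≈x (trans (*-congˡ y≈0) (zeroʳ z))) (+-identityʳ _)
    +0* : ∀ {x y u} → u ≈ x → y ≈ 0# → ∀ z → u + y * z ≈ x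
    +0* u≈x y≈0 z = trans (+-cong u≈x (trans (*-congʳ y≈0) (zeroˡ z))) (+-identityʳ _)
    *0+ : ∀ {x y u} → u ≈ x → y ≈ 0# → ∀ z → z * y + u ≈ x
    *0+ u≈x y≈0 z = trans (+-comm _ _) (+*0 u≈x y≈0 z)
    cancel : ∀ {x u v} → u ≈ x → v ≈ x → u + v ≈ 0#
    cancel u≈x v≈x = trans (+-cong u≈x v≈x) (x+x≈0 _)

    ee = pascal-even-even
    eo = pascal-even-odd
    oe = pascal-odd-even
    oo = pascal-odd-odd

    square : ∀ i j → sum (λ (k : Fin (double n)) → pascal (toℕ i) (toℕ k) * pascal (toℕ k) (toℕ j)) ≈
             reflected (double n) (toℕ i) (toℕ j)
    -- From here on `i` and `j` name the halves in `Fin n`, not the original indices.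
    square i j with toℕ i | lastBit {n} i | toℕ j | lastBit {n} j
    ... | _ | i , inj₁ ≡.refl | _ | j , inj₁ ≡.refl = trans
      (sum-double n (λ k → pascal (double (toℕ i)) k * pascal k (double (toℕ j)))
        (λ k → cancel (*-cong (ee (toℕ i) (toℕ k)) (ee (toℕ k) (toℕ j))) (*-cong (eo (toℕ i) (toℕ k)) (oe (toℕ k) (toℕ j)))))
      (trans (sum-zero {n} (λ _ → refl)) (sym (reflected-even-even i j)))
    ... | _ | i , inj₁ ≡.refl | _ | j , inj₂ ≡.refl = trans
      (sum-double n (λ k → pascal (double (toℕ i)) k * pascal k (suc (double (toℕ j))))
        (λ k → +*0 (*-cong (ee (toℕ i) (toℕ k)) (eo (toℕ k) (toℕ j))) (oo (toℕ k) (toℕ j)) _))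
      (trans (pascal² i j) (sym (reflected-even-odd i (toℕ j))))
    ... | _ | i , inj₂ ≡.refl | _ | j , inj₁ ≡.refl = trans
      (sum-double n (λ k → pascal (suc (double (toℕ i))) k * pascal k (double (toℕ j)))
        (λ k → +0* (*-cong (oe (toℕ i) (toℕ k)) (ee (toℕ k) (toℕ j))) (oo (toℕ i) (toℕ k)) _))
      (trans (pascal² i j) (sym (reflected-odd-even (toℕ i) j)))
    ... | _ | i , inj₂ ≡.refl | _ | j , inj₂ ≡.refl = trans
      (sum-double n (λ k → pascal (suc (double (toℕ i))) k * pascal k (suc (double (toℕ j))))
        (λ k → +0* (*-cong (oe (toℕ i) (toℕ k)) (eo (toℕ k) (toℕ j))) (oo (toℕ i) (toℕ k)) _))
      (trans (pascal² i j) (sym (reflected-odd-odd n (toℕ i) (toℕ j))))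

    cube : ∀ i j → sum (λ (k : Fin (double n)) → pascal (toℕ i) (toℕ k) * reflected (double n) (toℕ k) (toℕ j)) ≈
           δ (toℕ i) (toℕ j)
    cube i j with toℕ i | lastBit {n} i | toℕ j | lastBit {n} j
    ... | _ | i , inj₁ ≡.refl | _ | j , inj₁ ≡.refl = trans
      (sum-double n (λ k → pascal (double (toℕ i)) k * reflected (double n) k (double (toℕ j)))
        (λ k → *0+ (*-cong (eo (toℕ i) (toℕ k)) (reflected-odd-even (toℕ k) j)) (reflected-even-even k j) _))
      (trans (pascal³ i j) (reflexive (≡.sym (δ-even-even (toℕ i) (toℕ j)))))
    ... | _ | i , inj₁ ≡.refl | _ | j , inj₂ ≡.refl = trans
      (sum-double n (λ k → pascal (double (toℕ i)) k * reflected (double n) k (suc (double (toℕ j))))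
        (λ k → cancel (*-cong (ee (toℕ i) (toℕ k)) (reflected-even-odd k (toℕ j)))
                      (*-cong (eo (toℕ i) (toℕ k)) (reflected-odd-odd n (toℕ k) (toℕ j)))))
      (trans (sum-zero {n} (λ _ → refl)) (reflexive (≡.sym (δ-even-odd (toℕ i) (toℕ j)))))
    ... | _ | i , inj₂ ≡.refl | _ | j , inj₁ ≡.refl = trans
      (sum-double n (λ k → pascal (suc (double (toℕ i))) k * reflected (double n) k (double (toℕ j)))
        (λ k → +0* (trans (*-congˡ (reflected-even-even k j)) (zeroʳ _)) (oo (toℕ i) (toℕ k)) _))
      (trans (sum-zero {n} (λ _ → refl)) (reflexive (≡.sym (δ-odd-even (toℕ i) (toℕ j)))))
    ... | _ | i , inj₂ ≡.refl | _ | j , inj₂ ≡.refl = trans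
      (sum-double n (λ k → pascal (suc (double (toℕ i))) k * reflected (double n) k (suc (double (toℕ j))))
        (λ k → +0* (*-cong (oe (toℕ i) (toℕ k)) (reflected-even-odd k (toℕ j))) (oo (toℕ i) (toℕ k)) _))
      (trans (pascal³ i j) (reflexive (≡.sym (δ-even-even (toℕ i) (toℕ j)))))

  reflectedCube : ∀ l → ReflectedCube (2 ℕ.^ l)
  reflectedCube zero    = record
    { pascal² = λ { zero zero → trans (+-identityʳ _) (*-identityʳ 1#) }
    ; pascal³ = λ { zero zero → trans (+-identityʳ _) (*-identityʳ 1#) }
    }
  reflectedCube (suc l) =
    ≡.subst ReflectedCube (≡.sym (2^suc≡double l)) (reflectedCube-double (reflectedCube l))

  -- Both indices have binary digit `l` set. The induction strips last digits until that digit is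
  -- itself the last one, where the entry is `pascal 1 1` = 1 + 1; a pair of odd indices met earlier
  -- gives 0 at once.
  pascal-corner : ∀ l (i j : Fin (2 ℕ.^ l)) → pascal (2 ℕ.^ l ℕ.+ toℕ i) (2 ℕ.^ l ℕ.+ toℕ j) ≈ 0#
  pascal-corner zero    zero zero = x+x≈0 1#
  pascal-corner (suc l) = ≡.subst (λ n → (i j : Fin n) → pascal (n ℕ.+ toℕ i) (n ℕ.+ toℕ j) ≈ 0#)
    (≡.sym (2^suc≡double l)) corner
    where
    n = 2 ℕ.^ l
    IH : ∀ (i j : Fin n) {x} → x ≈ pascal (n ℕ.+ toℕ i) (n ℕ.+ toℕ j) → x ≈ 0#
    IH i j e = trans e (pascal-corner l i j)
    corner : ∀ (i j : Fin (double n)) → pascal (double n ℕ.+ toℕ i) (double n ℕ.+ toℕ j) ≈ 0#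
    corner i j with toℕ i | lastBit {n} i | toℕ j | lastBit {n} j
    ... | _ | i , inj₁ ≡.refl | _ | j , inj₁ ≡.refl
      rewrite ≡.sym (double-+ n (toℕ i)) | ≡.sym (double-+ n (toℕ j))
      = IH i j (pascal-even-even (n ℕ.+ toℕ i) (n ℕ.+ toℕ j))
    ... | _ | i , inj₁ ≡.refl | _ | j , inj₂ ≡.refl
      rewrite ℕₚ.+-suc (double n) (double (toℕ j)) | ≡.sym (double-+ n (toℕ i)) | ≡.sym (double-+ n (toℕ j))
      = IH i j (pascal-even-odd (n ℕ.+ toℕ i) (n ℕ.+ toℕ j))
    ... | _ | i , inj₂ ≡.refl | _ | j , inj₁ ≡.refl
      rewrite ℕₚ.+-suc (double n) (double (toℕ i)) | ≡.sym (double-+ n (toℕ i)) | ≡.sym (double-+ n (toℕ j))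
      = IH i j (pascal-odd-even (n ℕ.+ toℕ i) (n ℕ.+ toℕ j))
    ... | _ | i , inj₂ ≡.refl | _ | j , inj₂ ≡.refl
      rewrite ℕₚ.+-suc (double n) (double (toℕ i)) | ℕₚ.+-suc (double n) (double (toℕ j)) | ≡.sym (double-+ n (toℕ i)) | ≡.sym (double-+ n (toℕ j))
      = pascal-odd-odd (n ℕ.+ toℕ i) (n ℕ.+ toℕ j)

  pascal-corner′ : ∀ l m {k} → m ℕ.+ k ≡ 2 ℕ.^ suc l → k ℕ.≤ 2 ℕ.^ l →
                   (i j : Fin k) → pascal (m ℕ.+ toℕ i) (m ℕ.+ toℕ j) ≈ 0#
  pascal-corner′ l m {k} m+k≡2N k≤N i j =
    trans (reflexive (≡.cong₂ pascal (index i) (index j))) (pascal-corner l (shift i) (shift j))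
    where
    N = 2 ℕ.^ l
    r = N ℕ.∸ k
    m≡N+r : m ≡ N ℕ.+ r
    m≡N+r = ≡R.begin
      m                     ≡R.≡⟨ ℕₚ.m+n∸n≡m m k ⟨
      m ℕ.+ k ℕ.∸ k         ≡R.≡⟨ ≡.cong (ℕ._∸ k) m+k≡2N ⟩
      N ℕ.+ (N ℕ.+ 0) ℕ.∸ k ≡R.≡⟨ ≡.cong (λ x → N ℕ.+ x ℕ.∸ k) (ℕₚ.+-identityʳ N) ⟩
      N ℕ.+ N ℕ.∸ k         ≡R.≡⟨ ℕₚ.+-∸-assoc N k≤N ⟩
      N ℕ.+ r               ≡R.∎
    shift< : ∀ (i : Fin k) → r ℕ.+ toℕ i ℕ.< N
    shift< i = ≡.subst (r ℕ.+ toℕ i ℕ.<_) (ℕₚ.m∸n+n≡m k≤N) (ℕₚ.+-monoʳ-< r (Finₚ.toℕ<n i))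
    shift : Fin k → Fin N
    shift i = fromℕ< (shift< i)
    index : ∀ i → m ℕ.+ toℕ i ≡ N ℕ.+ toℕ (shift i)
    index i = ≡.trans (≡.cong (ℕ._+ toℕ i) m≡N+r)
      (≡.trans (ℕₚ.+-assoc N r (toℕ i)) (≡.cong (N ℕ.+_) (≡.sym (Finₚ.toℕ-fromℕ< (shift< i)))))

  -- The complementary minor identity.

  module Complement (t : Carrier) where

    T : ℕ → ℕ → Carrier
    T i j = t * δ i j + pascal i j

    -- The cofactor of `t + P` in `t³ + P³`, with `P²` already replaced by the reversed array. It is
    -- not the classical adjugate: its product with `T` is `s`, not the determinant, times the
    -- identity.
    Adj : ℕ → ℕ → ℕ → Carrier
    Adj n i j = (t * t * δ i j + t * pascal i j) + reflected n i j

    s : Carrier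
    s = t * (t * t) + 1#

    T·Adj : ∀ {n} → ReflectedCube n → ∀ i j → (⟦ T ⟧ n · ⟦ Adj n ⟧ n) i j ≈ s * δ (toℕ i) (toℕ j)
    T·Adj {n} r i j = begin
      sum (λ k → (t * d i k + p i k) * ((t * t * d k j + t * p k j) + q k j))
        ≈⟨ sum-cong-≋ (λ k → S.solve 6 (λ t d p d′ p′ q →
             (t S.:* d S.:+ p) S.:* ((t S.:* t S.:* d′ S.:+ t S.:* p′) S.:+ q) S.:=
             t S.:* (d S.:* ((t S.:* t S.:* d′ S.:+ t S.:* p′) S.:+ q)) S.:+
             (t S.:* t S.:* (p S.:* d′) S.:+ (t S.:* (p S.:* p′) S.:+ p S.:* q)))
             refl t (d i k) (p i k) (d k j) (p k j) (q k j)) ⟩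
      sum (λ k → t * (d i k * Adj n (toℕ k) (toℕ j)) +
                 (t * t * (p i k * d k j) + (t * (p i k * p k j) + p i k * q k j)))
        ≈⟨ ∑-distrib-+ (λ k → t * (d i k * Adj n (toℕ k) (toℕ j))) _ ⟩
      _ ≈⟨ +-cong (sym (*-distribˡ-sum t (λ k → d i k * Adj n (toℕ k) (toℕ j))))
             (trans (∑-distrib-+ (λ k → t * t * (p i k * d k j)) _)
             (+-cong (sym (*-distribˡ-sum (t * t) (λ k → p i k * d k j)))
             (trans (∑-distrib-+ (λ k → t * (p i k * p k j)) (λ k → p i k * q k j))
             (+-congʳ (sym (*-distribˡ-sum t (λ k → p i k * p k j))))))) ⟩
      t * sum (λ k → d i k * Adj n (toℕ k) (toℕ j)) +
        (t * t * sum (λ k → p i k * d k j) +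
          (t * sum (λ k → p i k * p k j) + sum (λ k → p i k * q k j)))
        ≈⟨ +-cong (*-congˡ (sum-δˡ i (λ k → Adj n (toℕ k) (toℕ j))))
             (+-cong (*-congˡ (sum-δʳ j (p i)))
             (+-cong (*-congˡ (pascal² i j)) (pascal³ i j))) ⟩
      t * ((t * t * d i j + t * p i j) + q i j) + (t * t * p i j + (t * q i j + d i j))
        ≈⟨ S.solve 4 (λ t d p q →
             t S.:* ((t S.:* t S.:* d S.:+ t S.:* p) S.:+ q) S.:+ (t S.:* t S.:* p S.:+ (t S.:* q S.:+ d)) S.:=
             (t S.:* (t S.:* t) S.:* d S.:+ d) S.:+ ((t S.:* t S.:* p S.:+ t S.:* q) S.:+ (t S.:* t S.:* p S.:+ t S.:* q)))
             refl t (d i j) (p i j) (q i j) ⟩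
      _ ≈⟨ +-dropʳ _ _ ⟩
      t * (t * t) * d i j + d i j
        ≈⟨ +-congˡ (*-identityˡ (d i j)) ⟨
      t * (t * t) * d i j + 1# * d i j
        ≈⟨ distribʳ (d i j) _ 1# ⟨
      s * d i j ∎
      where
      open ReflectedCube r
      d p q : Fin n → Fin n → Carrier
      d = ⟦ δ ⟧ n
      p = ⟦ pascal ⟧ n
      q = ⟦ reflected n ⟧ n

    -- Jacobi’s complementary minor formula for T, whose inverse is
    -- Adj / (t³ + 1).
    per-complement : ∀ l m k → m ℕ.+ k ≡ 2 ℕ.^ suc l → k ℕ.≤ 2 ℕ.^ l →
                     per (⟦ T ⟧ (m ℕ.+ k)) * (per (⟦ T ⟧ k) * per (⟦ T ⟧ k)) ≈ per (⟦ T ⟧ m) * s ^ k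
    per-complement l m k m+k≡2N k≤N = begin
      per (⟦ T ⟧ n) * (per (⟦ T ⟧ k) * per (⟦ T ⟧ k))
        ≈⟨ *-congˡ per-B ⟨
      per (⟦ T ⟧ n) * per B
        ≈⟨ per-· (⟦ T ⟧ n) B ⟨
      per (⟦ T ⟧ n · B)
        ≈⟨ per-blockLower m (⟦ T ⟧ n · B) (λ i j → trans (TB-right (i ↑ˡ k) j)
             (trans (*-congˡ (reflexive (δ-offDiagonal (ˡ≢ʳ i j)))) (zeroʳ s))) ⟩
      _ ≈⟨ *-cong (per-cong (λ i j → trans (TB-left (i ↑ˡ k) j)
                     (reflexive (≡.cong₂ T (Finₚ.toℕ-↑ˡ i k) (Finₚ.toℕ-↑ˡ j k)))))
                  (trans (per-cong (λ i j → trans (TB-right (m ↑ʳ i) j)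
                     (*-congˡ (reflexive (δ-↑ʳ i j))))) (per-scalar s k)) ⟩
      per (⟦ T ⟧ m) * s ^ k ∎
      where
      n = m ℕ.+ k
      cube : ReflectedCube n
      cube = ≡.subst ReflectedCube (≡.sym m+k≡2N) (reflectedCube (suc l))

      -- Identity columns keep the first `m` columns of `T` in the product `T · B`, and columns of
      -- `Adj` turn the last `k` into `s` times identity columns. Taking permanents of the product
      -- and of `B` itself gives the formula without inverting `s`.
      B : Matrix Carrier n
      B i j = [ (λ j → δ (toℕ i) (toℕ (j ↑ˡ k))) , (λ j → Adj n (toℕ i) (toℕ (m ↑ʳ j))) ]′ (splitAt m j)

      B-left : ∀ i j → B i (j ↑ˡ k) ≡ δ (toℕ i) (toℕ (j ↑ˡ k))
      B-left i j = ≡.cong [ _ , _ ]′ (Finₚ.splitAt-↑ˡ m j k)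
      B-right : ∀ i j → B i (m ↑ʳ j) ≡ Adj n (toℕ i) (toℕ (m ↑ʳ j))
      B-right i j = ≡.cong [ _ , _ ]′ (Finₚ.splitAt-↑ʳ m k j)

      TB-left : ∀ i j → (⟦ T ⟧ n · B) i (j ↑ˡ k) ≈ T (toℕ i) (toℕ (j ↑ˡ k))
      TB-left i j = trans (sum-cong-≋ (λ a → *-congˡ {T (toℕ i) (toℕ a)} (reflexive (B-left a j))))
        (sum-δʳ (j ↑ˡ k) (λ a → T (toℕ i) (toℕ a)))
      TB-right : ∀ i j → (⟦ T ⟧ n · B) i (m ↑ʳ j) ≈ s * δ (toℕ i) (toℕ (m ↑ʳ j))
      TB-right i j = trans (sum-cong-≋ (λ a → *-congˡ {T (toℕ i) (toℕ a)} (reflexive (B-right a j))))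
        (T·Adj cube i (m ↑ʳ j))

      ˡ≢ʳ : ∀ i j → toℕ (i ↑ˡ k) ≢ toℕ (m ↑ʳ j)
      ˡ≢ʳ i j rewrite Finₚ.toℕ-↑ˡ i k | Finₚ.toℕ-↑ʳ m j =
        ℕₚ.<⇒≢ (ℕₚ.<-≤-trans (Finₚ.toℕ<n i) (ℕₚ.m≤m+n m (toℕ j)))
      δ-↑ʳ : ∀ (i j : Fin k) → δ (toℕ (m ↑ʳ i)) (toℕ (m ↑ʳ j)) ≡ δ (toℕ i) (toℕ j)
      δ-↑ʳ i j rewrite Finₚ.toℕ-↑ʳ m i | Finₚ.toℕ-↑ʳ m j = δ-+ m (toℕ i) (toℕ j)

      -- On the last `k` indices, reversal within `n` is reversal within the first `k`, so the
      -- corner of the reversed array is `P(k)` reversed, whatever `m` is.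
      reflect : ∀ (i : Fin k) → n ℕ.∸ suc (toℕ (m ↑ʳ i)) ≡ toℕ (opposite i)
      reflect i = ≡R.begin
        n ℕ.∸ suc (toℕ (m ↑ʳ i))    ≡R.≡⟨ ≡.cong (λ a → n ℕ.∸ suc a) (Finₚ.toℕ-↑ʳ m i) ⟩
        n ℕ.∸ suc (m ℕ.+ toℕ i)     ≡R.≡⟨ ≡.cong (n ℕ.∸_) (ℕₚ.+-suc m (toℕ i)) ⟨
        n ℕ.∸ (m ℕ.+ suc (toℕ i))   ≡R.≡⟨ ℕₚ.[m+n]∸[m+o]≡n∸o m k (suc (toℕ i)) ⟩
        k ℕ.∸ suc (toℕ i)           ≡R.≡⟨ Finₚ.opposite-prop i ⟨
        toℕ (opposite i)            ≡R.∎

      T² : ∀ i j → T i j * T i j ≈ t * t * δ i j + pascal i j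
      T² i j = trans (+-square (t * δ i j) (pascal i j))
        (+-cong (trans (*-square t (δ i j)) (*-congˡ (δ-idem i j))) (pascal-idem i j))

      Adj-corner : ∀ (i j : Fin k) → Adj n (toℕ (m ↑ʳ i)) (toℕ (m ↑ʳ j)) ≈
                   ⟦ T ⟧ k (opposite i) (opposite j) * ⟦ T ⟧ k (opposite i) (opposite j)
      Adj-corner i j = begin
        (t * t * δ i′ j′ + t * pascal i′ j′) + pascal (n ℕ.∸ suc i′) (n ℕ.∸ suc j′)
          ≈⟨ +-cong (+-cong (*-congˡ (reflexive (≡.trans (δ-↑ʳ i j) (≡.sym (δ-opposite i j)))))
                            (trans (*-congˡ corner≈0) (zeroʳ t)))
                    (reflexive (≡.cong₂ pascal (reflect i) (reflect j))) ⟩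
        (t * t * δ i° j° + 0#) + pascal i° j°
          ≈⟨ +-congʳ (+-identityʳ _) ⟩
        t * t * δ i° j° + pascal i° j°
          ≈⟨ T² i° j° ⟨
        T i° j° * T i° j° ∎
        where
        i′ = toℕ (m ↑ʳ i)
        j′ = toℕ (m ↑ʳ j)
        i° = toℕ (opposite i)
        j° = toℕ (opposite j)
        corner≈0 : pascal i′ j′ ≈ 0#
        corner≈0 = trans (reflexive (≡.cong₂ pascal (Finₚ.toℕ-↑ʳ m i) (Finₚ.toℕ-↑ʳ m j)))
          (pascal-corner′ l m m+k≡2N k≤N i j)

      per-B : per B ≈ per (⟦ T ⟧ k) * per (⟦ T ⟧ k)
      per-B = begin
        per B
          ≈⟨ per-blockUpper m B
               (λ i j → trans (reflexive (B-left (i ↑ˡ k) j))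
                 (reflexive (≡.cong₂ δ (Finₚ.toℕ-↑ˡ i k) (Finₚ.toℕ-↑ˡ j k))))
               (λ i j → trans (reflexive (B-left (m ↑ʳ i) j))
                 (reflexive (δ-offDiagonal (ˡ≢ʳ j i ∘ ≡.sym)))) ⟩
        per (λ i j → B (m ↑ʳ i) (m ↑ʳ j))
          ≈⟨ per-cong (λ i j → trans (reflexive (B-right (m ↑ʳ i) j)) (Adj-corner i j)) ⟩
        per (λ i j → ⟦ T ⟧ k (opposite i) (opposite j) * ⟦ T ⟧ k (opposite i) (opposite j))
          ≈⟨ per-square (λ i j → ⟦ T ⟧ k (opposite i) (opposite j)) ⟩
        per (λ i j → ⟦ T ⟧ k (opposite i) (opposite j)) * per (λ i j → ⟦ T ⟧ k (opposite i) (opposite j))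
          ≈⟨ *-cong (per-opposite (⟦ T ⟧ k)) (per-opposite (⟦ T ⟧ k)) ⟩
        per (⟦ T ⟧ k) * per (⟦ T ⟧ k) ∎

-- The ring of polynomials over a coefficient ring with a chosen equality.

-- The equality of coefficients need not be the one of the raw ring, so that
-- the operations of ℤ[t] also serve as those of the quotient by 2.
module PolynomialRing {a ℓ₁ ℓ₂} (R : RawRing a ℓ₁) {_~_ : Rel (RawRing.Carrier R) ℓ₂}
  (isCommutativeRing : IsCommutativeRing _~_ (RawRing._+_ R) (RawRing._*_ R) (RawRing.-_ R)
                                         (RawRing.0# R) (RawRing.1# R)) where

  coefficientRing : CommutativeRing a ℓ₂
  coefficientRing = record { isCommutativeRing = isCommutativeRing }

  open CommutativeRing coefficientRing hiding (zero)
  open Polynomial R using (Poly; coeff; const; _⊕_; _⊗_; ⊝_)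

  infix 4 _≈ₚ_
  -- A record, so that unification recovers `p` and `q` from the type of a proof; the family of
  -- coefficient equalities would not determine them.
  record _≈ₚ_ (p q : Poly) : Set ℓ₂ where
    constructor coeffs
    field at : ∀ i → coeff p i ≈ coeff q i
  open _≈ₚ_ public

  scale : Carrier → Poly → Poly
  scale c = map (c *_)

  shift : Poly → Poly
  shift p = 0# ∷ p

  coeff-⊕ : ∀ p q i → coeff (p ⊕ q) i ≈ coeff p i + coeff q i
  coeff-⊕ []      q       i       = sym (+-identityˡ _)
  coeff-⊕ (c ∷ p) []      i       = sym (+-identityʳ _)
  coeff-⊕ (c ∷ p) (d ∷ q) zero    = refl
  coeff-⊕ (c ∷ p) (d ∷ q) (suc i) = coeff-⊕ p q i

  coeff-scale : ∀ c p i → coeff (scale c p) i ≈ c * coeff p i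
  coeff-scale c []      i       = sym (zeroʳ c)
  coeff-scale c (d ∷ p) zero    = refl
  coeff-scale c (d ∷ p) (suc i) = coeff-scale c p i

  coeff-⊝ : ∀ p i → coeff (⊝ p) i ≈ - coeff p i
  coeff-⊝ []      i       = sym (trans (sym (+-identityˡ _)) (-‿inverseʳ 0#))
  coeff-⊝ (c ∷ p) zero    = refl
  coeff-⊝ (c ∷ p) (suc i) = coeff-⊝ p i

  ∷-cong : ∀ {c d p q} → c ≈ d → p ≈ₚ q → (c ∷ p) ≈ₚ (d ∷ q)
  ∷-cong c≈d p≈q .at zero    = c≈d
  ∷-cong c≈d p≈q .at (suc i) = p≈q .at i

  ⊕-cong : ∀ {p p′ q q′} → p ≈ₚ p′ → q ≈ₚ q′ → p ⊕ q ≈ₚ p′ ⊕ q′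
  ⊕-cong {p} {p′} {q} {q′} e f .at i =
    trans (coeff-⊕ p q i) (trans (+-cong (e .at i) (f .at i)) (sym (coeff-⊕ p′ q′ i)))

  ⊕-isAbelianGroup : IsAbelianGroup _≈ₚ_ _⊕_ [] ⊝_
  ⊕-isAbelianGroup = record
    { isGroup = record
      { isMonoid = record
        { isSemigroup = record
          { isMagma = record
            { isEquivalence = record
              { refl  = coeffs λ i → refl
              ; sym   = λ e → coeffs λ i → sym (e .at i)
              ; trans = λ e f → coeffs λ i → trans (e .at i) (f .at i)
              }
            ; ∙-cong = ⊕-cong
            }
          ; assoc = λ p q r → coeffs λ i → begin
              coeff ((p ⊕ q) ⊕ r) i                  ≈⟨ trans (coeff-⊕ (p ⊕ q) r i) (+-congʳ (coeff-⊕ p q i)) ⟩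
              (coeff p i + coeff q i) + coeff r i    ≈⟨ +-assoc _ _ _ ⟩
              coeff p i + (coeff q i + coeff r i)    ≈⟨ trans (coeff-⊕ p (q ⊕ r) i) (+-congˡ (coeff-⊕ q r i)) ⟨
              coeff (p ⊕ (q ⊕ r)) i                  ∎
          }
        ; identity = (λ p → coeffs λ i → refl) , λ p → coeffs λ i → trans (coeff-⊕ p [] i) (+-identityʳ _)
        }
      ; inverse = (λ p → coeffs λ i → trans (coeff-⊕ (⊝ p) p i) (trans (+-congʳ (coeff-⊝ p i)) (-‿inverseˡ _)))
                , (λ p → coeffs λ i → trans (coeff-⊕ p (⊝ p) i) (trans (+-congˡ (coeff-⊝ p i)) (-‿inverseʳ _)))
      ; ⁻¹-cong = λ {p} {q} e → coeffs λ i → trans (coeff-⊝ p i) (trans (-‿cong (e .at i)) (sym (coeff-⊝ q i)))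
      }
    ; comm = λ p q → coeffs λ i → trans (coeff-⊕ p q i) (trans (+-comm _ _) (sym (coeff-⊕ q p i)))
    }
    where open SetoidReasoning setoid

  private
    ⊕-abelianGroup : AbelianGroup a ℓ₂
    ⊕-abelianGroup = record { isAbelianGroup = ⊕-isAbelianGroup }
    module ⊕ = AbelianGroup ⊕-abelianGroup
    open CommutativeSemigroupProperties ⊕.commutativeSemigroup using (interchange; x∙yz≈y∙xz)
    open SetoidReasoning ⊕.setoid

  shift-cong : ∀ {p q} → p ≈ₚ q → shift p ≈ₚ shift q
  shift-cong = ∷-cong refl

  shift-⊕ : ∀ p q → shift (p ⊕ q) ≈ₚ shift p ⊕ shift q
  shift-⊕ p q = ∷-cong (sym (+-identityˡ 0#)) ⊕.refl

  scale-congʳ : ∀ c {p q} → p ≈ₚ q → scale c p ≈ₚ scale c q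
  scale-congʳ c {p} {q} e .at i =
    trans (coeff-scale c p i) (trans (*-congˡ (e .at i)) (sym (coeff-scale c q i)))

  scale-⊕ : ∀ c p q → scale c (p ⊕ q) ≈ₚ scale c p ⊕ scale c q
  scale-⊕ c p q .at i =
    trans (coeff-scale c (p ⊕ q) i) (trans (*-congˡ (coeff-⊕ p q i)) (trans (distribˡ c _ _)
      (sym (trans (coeff-⊕ (scale c p) (scale c q) i) (+-cong (coeff-scale c p i) (coeff-scale c q i))))))

  scale-shift : ∀ c p → scale c (shift p) ≈ₚ shift (scale c p)
  scale-shift c p = ∷-cong (zeroʳ c) ⊕.refl

  scale-* : ∀ c d p → scale (c * d) p ≈ₚ scale c (scale d p)
  scale-* c d p .at i = trans (coeff-scale (c * d) p i) (trans (*-assoc c d _)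
    (sym (trans (coeff-scale c (scale d p) i) (*-congˡ (coeff-scale d p i)))))

  ⊗-congˡ : ∀ p {q r} → q ≈ₚ r → p ⊗ q ≈ₚ p ⊗ r
  ⊗-congˡ []      e = ⊕.refl
  ⊗-congˡ (c ∷ p) e = ⊕-cong (scale-congʳ c e) (shift-cong (⊗-congˡ p e))

  ⊗-distribˡ : ∀ p q r → p ⊗ (q ⊕ r) ≈ₚ p ⊗ q ⊕ p ⊗ r
  ⊗-distribˡ []      q r = ⊕.refl
  ⊗-distribˡ (c ∷ p) q r = begin
    scale c (q ⊕ r) ⊕ shift (p ⊗ (q ⊕ r))
      ≈⟨ ⊕-cong (scale-⊕ c q r) (⊕.trans (shift-cong (⊗-distribˡ p q r)) (shift-⊕ (p ⊗ q) (p ⊗ r))) ⟩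
    (scale c q ⊕ scale c r) ⊕ (shift (p ⊗ q) ⊕ shift (p ⊗ r))
      ≈⟨ interchange (scale c q) (scale c r) (shift (p ⊗ q)) (shift (p ⊗ r)) ⟩
    (scale c q ⊕ shift (p ⊗ q)) ⊕ (scale c r ⊕ shift (p ⊗ r)) ∎

  ⊗-zeroʳ : ∀ p → p ⊗ [] ≈ₚ []
  ⊗-zeroʳ []      = ⊕.refl
  ⊗-zeroʳ (c ∷ p) .at zero    = refl
  ⊗-zeroʳ (c ∷ p) .at (suc i) = ⊗-zeroʳ p .at i

  -- The mirror image of the clause defining `_⊗_`, which recurses on the left factor only.
  -- Commutativity follows by comparing the two.
  ⊗-∷ : ∀ p d q → p ⊗ (d ∷ q) ≈ₚ scale d p ⊕ shift (p ⊗ q)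
  ⊗-∷ []      d q .at zero    = refl
  ⊗-∷ []      d q .at (suc i) = refl
  ⊗-∷ (c ∷ p) d q = ∷-cong (+-congʳ (*-comm c d)) (begin
    scale c q ⊕ p ⊗ (d ∷ q)                    ≈⟨ ⊕.∙-congˡ (⊗-∷ p d q) ⟩
    scale c q ⊕ (scale d p ⊕ shift (p ⊗ q))    ≈⟨ x∙yz≈y∙xz (scale c q) (scale d p) (shift (p ⊗ q)) ⟩
    scale d p ⊕ (scale c q ⊕ shift (p ⊗ q))    ∎)

  ⊗-comm : ∀ p q → p ⊗ q ≈ₚ q ⊗ p
  ⊗-comm []      q = ⊕.sym (⊗-zeroʳ q)
  ⊗-comm (c ∷ p) q = ⊕.trans (⊕.∙-congˡ (shift-cong (⊗-comm p q))) (⊕.sym (⊗-∷ q c p))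

  ⊗-congʳ : ∀ r {p q} → p ≈ₚ q → p ⊗ r ≈ₚ q ⊗ r
  ⊗-congʳ r {p} {q} e = ⊕.trans (⊗-comm p r) (⊕.trans (⊗-congˡ r e) (⊗-comm r q))

  ⊗-distribʳ : ∀ r p q → (p ⊕ q) ⊗ r ≈ₚ p ⊗ r ⊕ q ⊗ r
  ⊗-distribʳ r p q = ⊕.trans (⊗-comm (p ⊕ q) r)
    (⊕.trans (⊗-distribˡ r p q) (⊕-cong (⊗-comm r p) (⊗-comm r q)))

  scale-⊗ : ∀ c p q → scale c p ⊗ q ≈ₚ scale c (p ⊗ q)
  scale-⊗ c []      q = ⊕.refl
  scale-⊗ c (d ∷ p) q = begin
    scale (c * d) q ⊕ shift (scale c p ⊗ q)
      ≈⟨ ⊕-cong (scale-* c d q) (⊕.trans (shift-cong (scale-⊗ c p q)) (⊕.sym (scale-shift c (p ⊗ q)))) ⟩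
    scale c (scale d q) ⊕ scale c (shift (p ⊗ q))
      ≈⟨ scale-⊕ c (scale d q) (shift (p ⊗ q)) ⟨
    scale c (scale d q ⊕ shift (p ⊗ q)) ∎

  shift-⊗ : ∀ p q → shift p ⊗ q ≈ₚ shift (p ⊗ q)
  shift-⊗ p q .at i = trans (coeff-⊕ (scale 0# q) (shift (p ⊗ q)) i)
    (trans (+-congʳ (trans (coeff-scale 0# q i) (zeroˡ _))) (+-identityˡ _))

  ⊗-assoc : ∀ p q r → (p ⊗ q) ⊗ r ≈ₚ p ⊗ (q ⊗ r)
  ⊗-assoc []      q r = ⊕.refl
  ⊗-assoc (c ∷ p) q r = begin
    (scale c q ⊕ shift (p ⊗ q)) ⊗ r
      ≈⟨ ⊗-distribʳ r (scale c q) (shift (p ⊗ q)) ⟩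
    scale c q ⊗ r ⊕ shift (p ⊗ q) ⊗ r
      ≈⟨ ⊕-cong (scale-⊗ c q r) (⊕.trans (shift-⊗ (p ⊗ q) r) (shift-cong (⊗-assoc p q r))) ⟩
    scale c (q ⊗ r) ⊕ shift (p ⊗ (q ⊗ r)) ∎

  ⊗-identityˡ : ∀ p → const 1# ⊗ p ≈ₚ p
  ⊗-identityˡ p .at i = trans (coeff-⊕ (scale 1# p) (shift []) i)
    (trans (+-cong (trans (coeff-scale 1# p i) (*-identityˡ _)) (shift[] i)) (+-identityʳ _))
    where
    shift[] : ∀ i → coeff (shift []) i ≈ 0#
    shift[] zero    = refl
    shift[] (suc i) = refl

  commutativeRing : CommutativeRing a ℓ₂
  commutativeRing = record
    { _≈_ = _≈ₚ_ ; _+_ = _⊕_ ; _*_ = _⊗_ ; -_ = ⊝_ ; 0# = [] ; 1# = const 1#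
    ; isCommutativeRing = record
      { isRing = record
        { +-isAbelianGroup = ⊕-isAbelianGroup
        ; *-cong           = λ {p} {p′} {q} {q′} e f → ⊕.trans (⊗-congʳ q e) (⊗-congˡ p′ f)
        ; *-assoc          = ⊗-assoc
        ; *-identity       = ⊗-identityˡ , λ p → ⊕.trans (⊗-comm p (const 1#)) (⊗-identityˡ p)
        ; distrib          = ⊗-distribˡ , ⊗-distribʳ
        }
      ; *-comm = ⊗-comm
      }
    }

  coeff-⊗-zero : ∀ p q i → (∀ j → j ℕ.≤ i → coeff q j ≈ 0#) → coeff (p ⊗ q) i ≈ 0#
  coeff-⊗-zero []      q i       q≈0 = refl
  coeff-⊗-zero (c ∷ p) q i       q≈0 = trans (coeff-⊕ (scale c q) (shift (p ⊗ q)) i)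
    (trans (+-cong (trans (coeff-scale c q i) (trans (*-congˡ (q≈0 i ℕₚ.≤-refl)) (zeroʳ c))) (rest i q≈0))
           (+-identityˡ 0#))
    where
    rest : ∀ i → (∀ j → j ℕ.≤ i → coeff q j ≈ 0#) → coeff (shift (p ⊗ q)) i ≈ 0#
    rest zero    q≈0 = refl
    rest (suc i) q≈0 = coeff-⊗-zero p q i (λ j j≤i → q≈0 j (ℕₚ.m≤n⇒m≤1+n j≤i))

  -- A constant term 1 makes `p` a unit among power series: coefficient `i` of the product is
  -- coefficient `i` of `q` plus multiples of earlier ones, so the coefficients of `q` vanish one
  -- after another.
  ⊗-zero⇒zero : ∀ p {q} → coeff p 0 ≈ 1# → p ⊗ q ≈ₚ [] → q ≈ₚ []
  ⊗-zero⇒zero []      {q} p₀≈1 pq≈0 .at i =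
    trans (sym (*-identityˡ _)) (trans (*-congʳ (sym p₀≈1)) (zeroˡ _))
  ⊗-zero⇒zero (c ∷ p) {q} c≈1  pq≈0 .at i = below i i ℕₚ.≤-refl
    where
    step : ∀ i → coeff (shift (p ⊗ q)) i ≈ 0# → coeff q i ≈ 0#
    step i rest≈0 = trans (sym (trans (coeff-⊕ (scale c q) (shift (p ⊗ q)) i)
      (trans (+-cong (trans (coeff-scale c q i) (trans (*-congʳ c≈1) (*-identityˡ _))) rest≈0) (+-identityʳ _))))
      (pq≈0 .at i)
    below : ∀ i j → j ℕ.≤ i → coeff q j ≈ 0#
    below zero    j ℕ.z≤n = step zero refl
    below (suc i) j j≤1+i with ℕₚ.m≤n⇒m<n∨m≡n j≤1+i
    ... | inj₁ (ℕ.s≤s j≤i) = below i j j≤i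
    ... | inj₂ ≡.refl      = step (suc i) (coeff-⊗-zero p q i (below i))

  ⊗-cancelˡ : ∀ p {q r} → coeff p 0 ≈ 1# → p ⊗ q ≈ₚ p ⊗ r → q ≈ₚ r
  ⊗-cancelˡ p {q} {r} p₀≈1 pq≈pr = P.trans (P.sym (P.+-identityʳ q)) (begin
    q ⊕ []            ≈⟨ P.+-congˡ (P.-‿inverseˡ r) ⟨
    q ⊕ (⊝ r ⊕ r)     ≈⟨ P.+-assoc q (⊝ r) r ⟨
    (q ⊕ ⊝ r) ⊕ r     ≈⟨ P.+-congʳ (⊗-zero⇒zero p p₀≈1 (begin
      p ⊗ (q ⊕ ⊝ r)       ≈⟨ ⊗-distribˡ p q (⊝ r) ⟩
      p ⊗ q ⊕ p ⊗ ⊝ r     ≈⟨ P.+-congʳ pq≈pr ⟩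
      p ⊗ r ⊕ p ⊗ ⊝ r     ≈⟨ ⊗-distribˡ p r (⊝ r) ⟨
      p ⊗ (r ⊕ ⊝ r)       ≈⟨ ⊗-congˡ p (P.-‿inverseʳ r) ⟩
      p ⊗ []              ≈⟨ ⊗-zeroʳ p ⟩
      []                  ∎)) ⟩
    r                 ∎)
    where module P = CommutativeRing commutativeRing

-- The exponents at powers of 2.

-- The exponents of t + 1 and t² + t + 1 in χ (2 ^ l).
c∞ e∞ : ℕ → ℕ
c∞ zero    = 1
c∞ (suc l) = 2 ℕ.* e∞ l
e∞ zero    = 0
e∞ (suc l) = c∞ l ℕ.+ e∞ l

c+2e≡2^ : ∀ l → c∞ l ℕ.+ 2 ℕ.* e∞ l ≡ 2 ℕ.^ l
c+2e≡2^ zero    = ≡.refl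
c+2e≡2^ (suc l) = ≡.trans
  (solve 2 (λ c e → con 2 :* e :+ con 2 :* (c :+ e) := con 2 :* (c :+ con 2 :* e)) ≡.refl (c∞ l) (e∞ l))
  (≡.cong (2 ℕ.*_) (c+2e≡2^ l))
  where open ℕSolver.+-*-Solver

-- The comparison is made after multiplying by 3, where `c-exact` removes the division. The
-- recursions of `c∞` and `e∞` are interlaced, so the companion formula (2ˡ - (-1)ˡ)/3 for `e∞` is
-- proved alongside.
c≡c∞ : ∀ l → c l ≡ + c∞ l
c≡c∞ l = ℤₚ.*-cancelʳ-≡ (c l) (+ c∞ l) (+ 3) (≡.trans (c-exact l) (≡.sym (c∞*3 l)))
  where
  open ℤSolver.+-*-Solver
  open ≡.≡-Reasoning
  c∞*3 : ∀ l → + c∞ l ℤ.* + 3 ≡ (+ 2) ℤ.^ l ℤ.+ + 2 ℤ.* ℤ.-1ℤ ℤ.^ l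
  e∞*3 : ∀ l → + e∞ l ℤ.* + 3 ≡ (+ 2) ℤ.^ l ℤ.- ℤ.-1ℤ ℤ.^ l
  c∞*3 zero    = ≡.refl
  c∞*3 (suc l) = begin
    + (2 ℕ.* e∞ l) ℤ.* + 3
      ≡⟨ ≡.cong (ℤ._* + 3) (ℤₚ.pos-* 2 (e∞ l)) ⟩
    + 2 ℤ.* + e∞ l ℤ.* + 3
      ≡⟨ ℤₚ.*-assoc (+ 2) (+ e∞ l) (+ 3) ⟩
    + 2 ℤ.* (+ e∞ l ℤ.* + 3)
      ≡⟨ ≡.cong (+ 2 ℤ.*_) (e∞*3 l) ⟩
    + 2 ℤ.* ((+ 2) ℤ.^ l ℤ.- ℤ.-1ℤ ℤ.^ l)
      ≡⟨ solve 2 (λ x y → con (+ 2) :* (x :- y) := con (+ 2) :* x :+ con (+ 2) :* (con ℤ.-1ℤ :* y))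
           ≡.refl ((+ 2) ℤ.^ l) (ℤ.-1ℤ ℤ.^ l) ⟩
    (+ 2) ℤ.^ suc l ℤ.+ + 2 ℤ.* ℤ.-1ℤ ℤ.^ suc l ∎
  e∞*3 zero    = ≡.refl
  e∞*3 (suc l) = begin
    (+ c∞ l ℤ.+ + e∞ l) ℤ.* + 3
      ≡⟨ ℤₚ.*-distribʳ-+ (+ 3) (+ c∞ l) (+ e∞ l) ⟩
    + c∞ l ℤ.* + 3 ℤ.+ + e∞ l ℤ.* + 3
      ≡⟨ ≡.cong₂ ℤ._+_ (c∞*3 l) (e∞*3 l) ⟩
    ((+ 2) ℤ.^ l ℤ.+ + 2 ℤ.* ℤ.-1ℤ ℤ.^ l) ℤ.+ ((+ 2) ℤ.^ l ℤ.- ℤ.-1ℤ ℤ.^ l)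
      ≡⟨ solve 2 (λ x y → (x :+ con (+ 2) :* y) :+ (x :- y) := con (+ 2) :* x :- con ℤ.-1ℤ :* y)
           ≡.refl ((+ 2) ℤ.^ l) (ℤ.-1ℤ ℤ.^ l) ⟩
    (+ 2) ℤ.^ suc l ℤ.- ℤ.-1ℤ ℤ.^ suc l ∎

-- Congruence of integers modulo 2.

infix 4 _≡₂_
-- The signed quotient is kept as data, so that every congruence law becomes a polynomial identity
-- for the solver; divisibility in `_≡_[mod_]` goes through absolute values.
record _≡₂_ (x y : ℤ) : Set where
  constructor _by_
  field
    quotient : ℤ
    equation : x ≡ y ℤ.+ quotient ℤ.* + 2

≡⇒≡₂ : ∀ {x y} → x ≡ y → x ≡₂ y
≡⇒≡₂ {x} {y} x≡y = 0ℤ by ≡.trans x≡y (≡.sym (ℤₚ.+-identityʳ y))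

≡₂⇒∣ : ∀ {x y} → x ≡₂ y → + 2 ∣ (x ℤ.- y)
≡₂⇒∣ {x} {y} (q by e) = Signed.∣⇒∣ᵤ (Signed.divides q (≡.trans (≡.cong (ℤ._- y) e)
  (solve 2 (λ y q → (y :+ q :* con (+ 2)) :- y := q :* con (+ 2)) ≡.refl y q)))
  where open ℤSolver.+-*-Solver

≡₂-isCommutativeRing : IsCommutativeRing _≡₂_ ℤ._+_ ℤ._*_ ℤ.-_ 0ℤ 1ℤ
≡₂-isCommutativeRing = record
  { isRing = record
    { +-isAbelianGroup = record
      { isGroup = record
        { isMonoid = record
          { isSemigroup = record
            { isMagma = record
              { isEquivalence = record { refl = ≡⇒≡₂ ≡.refl ; sym = sym₂ ; trans = trans₂ }
              ; ∙-cong        = +-cong₂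
              }
            ; assoc = λ x y z → ≡⇒≡₂ (ℤₚ.+-assoc x y z)
            }
          ; identity = (λ x → ≡⇒≡₂ (ℤₚ.+-identityˡ x)) , (λ x → ≡⇒≡₂ (ℤₚ.+-identityʳ x))
          }
        ; inverse = (λ x → ≡⇒≡₂ (ℤₚ.+-inverseˡ x)) , (λ x → ≡⇒≡₂ (ℤₚ.+-inverseʳ x))
        ; ⁻¹-cong = neg-cong₂
        }
      ; comm = λ x y → ≡⇒≡₂ (ℤₚ.+-comm x y)
      }
    ; *-cong     = *-cong₂
    ; *-assoc    = λ x y z → ≡⇒≡₂ (ℤₚ.*-assoc x y z)
    ; *-identity = (λ x → ≡⇒≡₂ (ℤₚ.*-identityˡ x)) , (λ x → ≡⇒≡₂ (ℤₚ.*-identityʳ x))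
    ; distrib    = (λ x y z → ≡⇒≡₂ (ℤₚ.*-distribˡ-+ x y z)) , (λ x y z → ≡⇒≡₂ (ℤₚ.*-distribʳ-+ x y z))
    }
  ; *-comm = λ x y → ≡⇒≡₂ (ℤₚ.*-comm x y)
  }
  where
  open ℤSolver.+-*-Solver
  sym₂ : ∀ {x y} → x ≡₂ y → y ≡₂ x
  sym₂ {_} {y} (q by ≡.refl) = (ℤ.- q) by
    solve 2 (λ y q → y := (y :+ q :* con (+ 2)) :+ (:- q) :* con (+ 2)) ≡.refl y q
  trans₂ : ∀ {x y z} → x ≡₂ y → y ≡₂ z → x ≡₂ z
  trans₂ {_} {_} {z} (q by ≡.refl) (r by ≡.refl) = (q ℤ.+ r) by
    solve 3 (λ z q r → (z :+ r :* con (+ 2)) :+ q :* con (+ 2) := z :+ (q :+ r) :* con (+ 2)) ≡.refl z q r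
  +-cong₂ : ∀ {x x′ y y′} → x ≡₂ x′ → y ≡₂ y′ → x ℤ.+ y ≡₂ x′ ℤ.+ y′
  +-cong₂ {_} {x} {_} {y} (q by ≡.refl) (r by ≡.refl) = (q ℤ.+ r) by
    solve 4 (λ x y q r → (x :+ q :* con (+ 2)) :+ (y :+ r :* con (+ 2)) :=
                         (x :+ y) :+ (q :+ r) :* con (+ 2)) ≡.refl x y q r
  *-cong₂ : ∀ {x x′ y y′} → x ≡₂ x′ → y ≡₂ y′ → x ℤ.* y ≡₂ x′ ℤ.* y′
  *-cong₂ {_} {x} {_} {y} (q by ≡.refl) (r by ≡.refl) = (x ℤ.* r ℤ.+ q ℤ.* y ℤ.+ q ℤ.* r ℤ.* + 2) by
    solve 4 (λ x y q r → (x :+ q :* con (+ 2)) :* (y :+ r :* con (+ 2)) :=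
                         x :* y :+ (x :* r :+ q :* y :+ q :* r :* con (+ 2)) :* con (+ 2)) ≡.refl x y q r
  neg-cong₂ : ∀ {x y} → x ≡₂ y → ℤ.- x ≡₂ ℤ.- y
  neg-cong₂ {_} {y} (q by ≡.refl) = (ℤ.- q) by
    solve 2 (λ y q → :- (y :+ q :* con (+ 2)) := :- y :+ (:- q) :* con (+ 2)) ≡.refl y q

ℤ₂[t] : CommutativeRing _ _
ℤ₂[t] = PolynomialRing.commutativeRing ℤ.+-*-rawRing ≡₂-isCommutativeRing

open PolynomialRing ℤ.+-*-rawRing ≡₂-isCommutativeRing
  using (_≈ₚ_; coeffs; at; coeff-⊕; coeff-scale; ⊗-cancelˡ)

⊕-self : ∀ p → p ℤ[t].⊕ p ≈ₚ []
⊕-self p .at i = trans (coeff-⊕ p p i) (x by solve 1 (λ x → x :+ x := con 0ℤ :+ x :* con (+ 2)) ≡.refl x)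
  where
  open CommutativeRing (PolynomialRing.coefficientRing ℤ.+-*-rawRing ≡₂-isCommutativeRing) using (trans)
  open ℤSolver.+-*-Solver
  x = ℤ[t].coeff p i

-- Factorisation of the characteristic polynomials modulo 2.

module Modulo2 where
  open CommutativeRing ℤ₂[t] hiding (zero)
  open Char2 ℤ₂[t] ⊕-self
  open Complement ℤ[t].t
  open SemiringSum semiring
  open SemiringExp semiring using (_^_; ^-congˡ; ^-homo-*)
  open CommutativeSemiringExp commutativeSemiring using (^-distrib-*)
  open SetoidReasoning setoid
  open CommutativeSemigroupProperties *-commutativeSemigroup using () renaming (interchange to *-interchange)

  -‿id : ∀ x → - x ≈ x
  -‿id x = +≈0⇒≈ (-‿inverseˡ x)

  det≈per : ∀ {n} (M : Matrix Carrier n) → ℤ[t].det M ≈ per M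
  det≈per {zero}  M = refl
  det≈per {suc n} M = sum-cong-≋ λ j → trans
    (*-cong {y = 1#} (sign≈1 (toℕ j)) (*-congˡ {M zero j} (det≈per (λ i k → M (suc i) (punchIn j k)))))
    (*-identityˡ (M zero j * per (λ i k → M (suc i) (punchIn j k))))
    where
    sign≈1 : ∀ j → (- 1#) ℤ[t].^ j ≈ 1#
    sign≈1 zero    = refl
    sign≈1 (suc j) = trans (*-cong (-‿id 1#) (sign≈1 j)) (*-identityˡ 1#)

  I≈δ : ∀ {n} (i j : Fin n) → ℤ[t].I n i j ≈ δ (toℕ i) (toℕ j)
  I≈δ i j with i Finₚ.≟ j
  ... | yes ≡.refl = reflexive (≡.sym (δ-diagonal (toℕ i)))
  ... | no  i≢j    = reflexive (≡.sym (δ-offDiagonal (λ e → i≢j (Finₚ.toℕ-injective e))))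

  pascal≡C : ∀ i j → pascal i j ≡ ℤ[t].const (+ ((i ℕ.+ j) C i))
  pascal≡C zero    j       = ≡.refl
  pascal≡C (suc i) zero    rewrite ℕₚ.+-identityʳ i | nCn≡1 (suc i) = ≡.refl
  pascal≡C (suc i) (suc j) = ≡.trans (≡.cong₂ _+_ (pascal≡C i (suc j)) (pascal≡C (suc i) j))
    (≡.cong (λ a → ℤ[t].const (+ a)) (≡.trans
      (≡.cong (λ a → (i ℕ.+ suc j) C i ℕ.+ a C suc i) (≡.sym (ℕₚ.+-suc i j)))
      (nCk+nC[k+1]≡[n+1]C[k+1] (i ℕ.+ suc j) i)))

  χ≈per : ∀ n → χ n ≈ per (⟦ T ⟧ n)
  χ≈per n = trans (det≈per {n} _) (per-cong λ i j → +-cong (*-congˡ {ℤ[t].t} (I≈δ i j))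
    (trans (-‿id (ℤ[t].const (P n i j))) (reflexive (≡.sym (pascal≡C (toℕ i) (toℕ j))))))

  a b : Carrier
  a = ℤ[t].t + 1#
  b = ℤ[t].t ℤ[t].^ 2 + ℤ[t].t + 1#

  s≈ab : s ≈ a * b
  s≈ab .at 0 = 0ℤ by ≡.refl
  -- Over the integers `a * b` is 1 + 2t + 2t² + t³, whence the quotient -1 in degrees 1 and 2.
  s≈ab .at 1 = (ℤ.- 1ℤ) by ≡.refl
  s≈ab .at 2 = (ℤ.- 1ℤ) by ≡.refl
  s≈ab .at 3 = 0ℤ by ≡.refl
  s≈ab .at (suc (suc (suc (suc i)))) = go i
    where
    go : ∀ i → ℤ[t].coeff s (suc (suc (suc (suc i)))) ≡₂ ℤ[t].coeff (a * b) (suc (suc (suc (suc i))))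
    go zero          = 0ℤ by ≡.refl
    go (suc zero)    = 0ℤ by ≡.refl
    go (suc (suc i)) = 0ℤ by ≡.refl

  u : ℕ → ℕ → Carrier
  u x y = a ^ x * b ^ y

  u-+ : ∀ x y x′ y′ → u (x ℕ.+ x′) (y ℕ.+ y′) ≈ u x y * u x′ y′
  u-+ x y x′ y′ = trans (*-cong (^-homo-* a x x′) (^-homo-* b y y′))
    (*-interchange (a ^ x) (a ^ x′) (b ^ y) (b ^ y′))

  s^≈u : ∀ k → s ^ k ≈ u k k
  s^≈u k = trans (^-congˡ k s≈ab) (^-distrib-* a b k)

  coeff₀-* : ∀ p q → ℤ[t].coeff p 0 ≡₂ 1ℤ → ℤ[t].coeff q 0 ≡₂ 1ℤ → ℤ[t].coeff (p * q) 0 ≡₂ 1ℤ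
  coeff₀-* []      q e f = e
  coeff₀-* (x ∷ p) q e f = Z.trans (coeff-⊕ (map (x ℤ.*_) q) _ 0) (Z.trans (Z.+-identityʳ _)
    (Z.trans (coeff-scale x q 0) (Z.trans (Z.*-cong e f) (Z.*-identityˡ 1ℤ))))
    where module Z = CommutativeRing (PolynomialRing.coefficientRing ℤ.+-*-rawRing ≡₂-isCommutativeRing)

  coeff₀-^ : ∀ p n → ℤ[t].coeff p 0 ≡₂ 1ℤ → ℤ[t].coeff (p ^ n) 0 ≡₂ 1ℤ
  coeff₀-^ p zero    e = ≡⇒≡₂ ≡.refl
  coeff₀-^ p (suc n) e = coeff₀-* p (p ^ n) e (coeff₀-^ p n e)

  -- Division of monomials in `a` and `b`: both have constant term 1, hence so does `u x y`, which
  -- can be cancelled. The equations for `z` and `w` express subtraction of exponents without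
  -- truncation.
  u-cancel : ∀ {p} x y x′ y′ {z w} → z ≡ x ℕ.+ x′ → w ≡ y ℕ.+ y′ → p * u x y ≈ u z w → p ≈ u x′ y′
  u-cancel {p} x y x′ y′ ≡.refl ≡.refl e = ⊗-cancelˡ (u x y)
    (coeff₀-* (a ^ x) (b ^ y) (coeff₀-^ a x (≡⇒≡₂ ≡.refl)) (coeff₀-^ b y (≡⇒≡₂ ≡.refl)))
    (trans (*-comm (u x y) p) (trans e (u-+ x y x′ y′)))

  χ-complement : ∀ l m k g h → m ℕ.+ k ≡ 2 ℕ.^ suc l → k ℕ.≤ 2 ℕ.^ l → χ k ≈ u g h →
                 χ (2 ℕ.^ suc l) * u (g ℕ.+ g) (h ℕ.+ h) ≈ χ m * u k k
  χ-complement l m k g h m+k≡2N k≤N χk≈u = begin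
    χ (2 ℕ.^ suc l) * u (g ℕ.+ g) (h ℕ.+ h)
      ≈⟨ *-cong (trans (reflexive (≡.cong χ (≡.sym m+k≡2N))) (χ≈per (m ℕ.+ k)))
                (trans (u-+ g h g h) (*-cong u≈per u≈per)) ⟩
    per (⟦ T ⟧ (m ℕ.+ k)) * (per (⟦ T ⟧ k) * per (⟦ T ⟧ k))
      ≈⟨ per-complement l m k m+k≡2N k≤N ⟩
    per (⟦ T ⟧ m) * s ^ k
      ≈⟨ *-cong (sym (χ≈per m)) (s^≈u k) ⟩
    χ m * u k k ∎
    where
    u≈per : u g h ≈ per (⟦ T ⟧ k)
    u≈per = trans (sym χk≈u) (χ≈per k)

  -- The two inequalities make the exponents in factorisation-reflect
  -- nonnegative.
  record Factorisation (γ : ℕ → ℤ) (l n : ℕ) : Set where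
    field
      g h  : ℕ
      size : g ℕ.+ 2 ℕ.* h ≡ n
      γ≡g  : γ n ≡ + g
      2h≤  : 2 ℕ.* h ℕ.≤ g ℕ.+ 2 ℕ.* e∞ l
      g≤   : g ℕ.≤ c∞ l ℕ.+ e∞ l
      χ≈u  : χ n ≈ u g h

  factorisation-weaken : ∀ {γ l n} → Factorisation γ l n → Factorisation γ (suc l) n
  factorisation-weaken {l = l} f = record
    { g = g ; h = h ; size = size ; γ≡g = γ≡g ; χ≈u = χ≈u
    ; 2h≤ = ℕₚ.≤-trans 2h≤ (ℕₚ.+-monoʳ-≤ g (ℕₚ.*-monoʳ-≤ 2 (ℕₚ.m≤n+m (e∞ l) (c∞ l))))
    ; g≤  = ℕₚ.≤-trans g≤ (ℕₚ.m≤n+m (c∞ l ℕ.+ e∞ l) (2 ℕ.* e∞ l))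
    }
    where open Factorisation f

  χ-power : ∀ l → χ (2 ℕ.^ l) ≈ u (c∞ l) (e∞ l)
  χ-power zero    = trans (χ≈per 1) (begin
    (ℤ[t].t * 1# + 1#) * 1# + 0#  ≈⟨ trans (+-identityʳ _) (*-identityʳ _) ⟩
    ℤ[t].t * 1# + 1#              ≈⟨ +-congʳ {1#} (*-identityʳ ℤ[t].t) ⟩
    a                             ≈⟨ trans (*-identityʳ _) (*-identityʳ a) ⟨
    u 1 0                         ∎)
  -- With `q = cₗ + 2 eₗ`, the case `k = q` leaves the exponents `cₗ + q - 2 cₗ = 2 eₗ` and
  -- `eₗ + q - 2 eₗ = cₗ + eₗ`, which are the recursions of `c∞` and `e∞`.
  χ-power (suc l) = u-cancel (cₗ ℕ.+ cₗ) (eₗ ℕ.+ eₗ) (2 ℕ.* eₗ) (cₗ ℕ.+ eₗ)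
    (≡.trans (≡.cong (cₗ ℕ.+_) (≡.sym (c+2e≡2^ l)))
      (solve 2 (λ cₗ eₗ → cₗ :+ (cₗ :+ con 2 :* eₗ) := (cₗ :+ cₗ) :+ con 2 :* eₗ) ≡.refl cₗ eₗ))
    (≡.trans (≡.cong (eₗ ℕ.+_) (≡.sym (c+2e≡2^ l)))
      (solve 2 (λ cₗ eₗ → eₗ :+ (cₗ :+ con 2 :* eₗ) := (eₗ :+ eₗ) :+ (cₗ :+ eₗ)) ≡.refl cₗ eₗ))
    (begin
      χ (2 ℕ.^ suc l) * u (cₗ ℕ.+ cₗ) (eₗ ℕ.+ eₗ)
        ≈⟨ χ-complement l q q cₗ eₗ (≡.cong (q ℕ.+_) (≡.sym (ℕₚ.+-identityʳ q))) ℕₚ.≤-refl (χ-power l) ⟩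
      χ q * u q q
        ≈⟨ *-congʳ (χ-power l) ⟩
      u cₗ eₗ * u q q
        ≈⟨ u-+ cₗ eₗ q q ⟨
      u (cₗ ℕ.+ q) (eₗ ℕ.+ q) ∎)
    where
    open ℕSolver.+-*-Solver
    q = 2 ℕ.^ l
    cₗ = c∞ l
    eₗ = e∞ l

  factorisation-reflect : ∀ {γ} → IsGamma γ → ∀ l k → k ℕ.≤ 2 ℕ.^ l →
                          Factorisation γ l k → Factorisation γ (suc l) (2 ℕ.^ suc l ℕ.∸ k)
  factorisation-reflect {γ} isGamma l k k≤q f = record
    { g    = G
    ; h    = H
    ; size = ≡.trans (≡.sym (ℕₚ.m+n∸n≡m (G ℕ.+ 2 ℕ.* H) k)) (≡.cong (ℕ._∸ k) size′)
    ; γ≡g  = γ≡G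
    -- Dropping the subtractions is enough: `2 * H` is at most `2 * e∞ (suc l)` outright, and the
    -- old bound on `g` bounds `G`.
    ; 2h≤  = ℕₚ.≤-trans (ℕₚ.*-monoʳ-≤ 2 (ℕₚ.m∸n≤m (cₗ ℕ.+ eₗ) g)) (ℕₚ.m≤n+m (2 ℕ.* (cₗ ℕ.+ eₗ)) G)
    ; g≤   = ℕₚ.≤-trans (ℕₚ.m∸n≤m (2 ℕ.* eₗ ℕ.+ g) (2 ℕ.* h)) (ℕₚ.+-monoʳ-≤ (2 ℕ.* eₗ) g≤)
    ; χ≈u  = u-cancel k k G H
        (≡R.begin
          2 ℕ.* eₗ ℕ.+ (g ℕ.+ g)      ≡R.≡⟨ ℕₚ.+-assoc (2 ℕ.* eₗ) g g ⟨
          2 ℕ.* eₗ ℕ.+ g ℕ.+ g        ≡R.≡⟨ ≡.cong (ℕ._+ g) G+2h ⟨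
          G ℕ.+ 2 ℕ.* h ℕ.+ g        ≡R.≡⟨ solve 3 (λ G h g → G :+ con 2 :* h :+ g := (g :+ con 2 :* h) :+ G) ≡.refl G h g ⟩
          g ℕ.+ 2 ℕ.* h ℕ.+ G        ≡R.≡⟨ ≡.cong (ℕ._+ G) size ⟩
          k ℕ.+ G                    ≡R.∎)
        (≡R.begin
          cₗ ℕ.+ eₗ ℕ.+ (h ℕ.+ h)      ≡R.≡⟨ ≡.cong (ℕ._+ (h ℕ.+ h)) H+g ⟨
          H ℕ.+ g ℕ.+ (h ℕ.+ h)      ≡R.≡⟨ solve 3 (λ H g h → H :+ g :+ (h :+ h) := (g :+ con 2 :* h) :+ H) ≡.refl H g h ⟩
          g ℕ.+ 2 ℕ.* h ℕ.+ H        ≡R.≡⟨ ≡.cong (ℕ._+ H) size ⟩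
          k ℕ.+ H                    ≡R.∎)
        (begin
          χ n * u k k                                      ≈⟨ χ-complement l n k g h (ℕₚ.m∸n+n≡m k≤2q) k≤q χ≈u ⟨
          χ (2 ℕ.^ suc l) * u (g ℕ.+ g) (h ℕ.+ h)          ≈⟨ *-congʳ (χ-power (suc l)) ⟩
          u (2 ℕ.* eₗ) (cₗ ℕ.+ eₗ) * u (g ℕ.+ g) (h ℕ.+ h)    ≈⟨ u-+ (2 ℕ.* eₗ) (cₗ ℕ.+ eₗ) (g ℕ.+ g) (h ℕ.+ h) ⟨
          u (2 ℕ.* eₗ ℕ.+ (g ℕ.+ g)) (cₗ ℕ.+ eₗ ℕ.+ (h ℕ.+ h)) ∎)
    }
    where
    open Factorisation f
    open ℕSolver.+-*-Solver
    module ≡R = ≡.≡-Reasoning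
    cₗ = c∞ l
    eₗ = e∞ l
    n = 2 ℕ.^ suc l ℕ.∸ k
    -- Comparing `χ n * s ^ k` with `χ (2 ^ suc l)` times the square of `χ k` gives the exponents
    -- `2 eₗ + 2 g - k` and `cₗ + eₗ + 2 h - k`; substituting `k = g + 2 h` yields these forms. As
    -- `c (suc l)` is `2 eₗ`, the first is also what the recursion of `γ` prescribes.
    G = 2 ℕ.* eₗ ℕ.+ g ℕ.∸ 2 ℕ.* h
    H = cₗ ℕ.+ eₗ ℕ.∸ g
    G+2h : G ℕ.+ 2 ℕ.* h ≡ 2 ℕ.* eₗ ℕ.+ g
    G+2h = ℕₚ.m∸n+n≡m (≡.subst (2 ℕ.* h ℕ.≤_) (ℕₚ.+-comm g (2 ℕ.* eₗ)) 2h≤)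
    H+g : H ℕ.+ g ≡ cₗ ℕ.+ eₗ
    H+g = ℕₚ.m∸n+n≡m g≤
    k≤2q : k ℕ.≤ 2 ℕ.^ suc l
    k≤2q = ℕₚ.≤-trans k≤q (ℕₚ.m≤m+n _ _)
    size′ : G ℕ.+ 2 ℕ.* H ℕ.+ k ≡ 2 ℕ.^ suc l
    size′ = ≡R.begin
      G ℕ.+ 2 ℕ.* H ℕ.+ k                          ≡R.≡⟨ ≡.cong (G ℕ.+ 2 ℕ.* H ℕ.+_) size ⟨
      G ℕ.+ 2 ℕ.* H ℕ.+ (g ℕ.+ 2 ℕ.* h)            ≡R.≡⟨ solve 4 (λ G H g h → G :+ con 2 :* H :+ (g :+ con 2 :* h) :=
                                                            (G :+ con 2 :* h) :+ (con 2 :* H :+ g)) ≡.refl G H g h ⟩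
      G ℕ.+ 2 ℕ.* h ℕ.+ (2 ℕ.* H ℕ.+ g)            ≡R.≡⟨ ≡.cong (ℕ._+ (2 ℕ.* H ℕ.+ g)) G+2h ⟩
      2 ℕ.* eₗ ℕ.+ g ℕ.+ (2 ℕ.* H ℕ.+ g)            ≡R.≡⟨ solve 3 (λ eₗ g H → con 2 :* eₗ :+ g :+ (con 2 :* H :+ g) :=
                                                            con 2 :* eₗ :+ con 2 :* (H :+ g)) ≡.refl eₗ g H ⟩
      2 ℕ.* eₗ ℕ.+ 2 ℕ.* (H ℕ.+ g)                  ≡R.≡⟨ ≡.cong (λ x → 2 ℕ.* eₗ ℕ.+ 2 ℕ.* x) H+g ⟩
      2 ℕ.* eₗ ℕ.+ 2 ℕ.* (cₗ ℕ.+ eₗ)                  ≡R.≡⟨ c+2e≡2^ (suc l) ⟩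
      2 ℕ.^ suc l                                  ≡R.∎
    γ≡G : γ n ≡ + G
    γ≡G = ≡R.begin
      γ n
        ≡R.≡⟨ IsGamma.γ-rec isGamma (suc l) k (ℕₚ.*-monoʳ-≤ 2 k≤q) ⟩
      Defs.c (suc l) ℤ.- + k ℤ.+ + 2 ℤ.* γ k
        ≡R.≡⟨ ≡.cong₂ (λ x y → x ℤ.- + k ℤ.+ + 2 ℤ.* y) (c≡c∞ (suc l)) γ≡g ⟩
      + (2 ℕ.* eₗ) ℤ.- + k ℤ.+ + 2 ℤ.* + g
        ≡R.≡⟨ ≡.cong (λ x → + (2 ℕ.* eₗ) ℤ.- + x ℤ.+ + 2 ℤ.* + g) size ⟨
      + (2 ℕ.* eₗ) ℤ.- (+ g ℤ.+ + (2 ℕ.* h)) ℤ.+ + 2 ℤ.* + g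
        ≡R.≡⟨ Z.solve 3 (λ eₗ g h → eₗ Z.:- (g Z.:+ h) Z.:+ Z.con (+ 2) Z.:* g Z.:= (eₗ Z.:+ g) Z.:- h) ≡.refl
              (+ (2 ℕ.* eₗ)) (+ g) (+ (2 ℕ.* h)) ⟩
      + (2 ℕ.* eₗ ℕ.+ g) ℤ.- + (2 ℕ.* h)
        ≡R.≡⟨ ≡.cong (λ x → + x ℤ.- + (2 ℕ.* h)) G+2h ⟨
      (+ G ℤ.+ + (2 ℕ.* h)) ℤ.- + (2 ℕ.* h)
        ≡R.≡⟨ Z.solve 2 (λ G h → (G Z.:+ h) Z.:- h Z.:= G) ≡.refl (+ G) (+ (2 ℕ.* h)) ⟩
      + G ≡R.∎
      where module Z = ℤSolver.+-*-Solver

  -- Induction on the exponent of the bounding power of 2: an `n` above half of the bound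
  -- `2 ^ suc l` is reflected to `2 ^ suc l - n`, which is at most `2 ^ l` and so covered one level
  -- below.
  factorisation : ∀ {γ} → IsGamma γ → ∀ l n → n ℕ.≤ 2 ℕ.^ l → Factorisation γ l n
  factorisation isGamma zero zero n≤ = record
    { g = 0 ; h = 0 ; size = ≡.refl ; γ≡g = IsGamma.γ-zero isGamma
    ; 2h≤ = ℕ.z≤n ; g≤ = ℕ.z≤n ; χ≈u = sym (*-identityˡ 1#) }
  factorisation isGamma zero (suc zero) n≤ = record
    { g = 1 ; h = 0 ; size = ≡.refl
    ; γ≡g = ≡.trans (IsGamma.γ-rec isGamma 0 0 ℕ.z≤n) (≡.cong (λ x → 1ℤ ℤ.+ + 2 ℤ.* x) (IsGamma.γ-zero isGamma))
    ; 2h≤ = ℕ.z≤n ; g≤ = ℕₚ.≤-refl ; χ≈u = χ-power 0 }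
  factorisation isGamma zero (suc (suc n)) (ℕ.s≤s ())
  factorisation {γ} isGamma (suc l) n n≤ with n ℕₚ.≤? 2 ℕ.^ l
  ... | yes n≤q = factorisation-weaken (factorisation isGamma l n n≤q)
  ... | no  n≰q = ≡.subst (Factorisation γ (suc l)) (ℕₚ.m∸[m∸n]≡n n≤)
    (factorisation-reflect isGamma l (2 ℕ.^ suc l ℕ.∸ n) k≤q (factorisation isGamma l _ k≤q))
    where
    q = 2 ℕ.^ l
    k≤q : 2 ℕ.^ suc l ℕ.∸ n ℕ.≤ q
    k≤q = ℕₚ.m≤n+o⇒m∸n≤o (2 ℕ.^ suc l) n (≡.subst (ℕ._≤ n ℕ.+ q)
      (≡.cong (q ℕ.+_) (≡.sym (ℕₚ.+-identityʳ q))) (ℕₚ.+-monoˡ-≤ q (ℕₚ.<⇒≤ (ℕₚ.≰⇒> n≰q))))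

  ^≡^ : ∀ x n → x ℤ[t].^ n ≡ x ^ n
  ^≡^ x zero    = ≡.refl
  ^≡^ x (suc n) = ≡.cong (x *_) (^≡^ x n)

-- Passage from the ring modulo 2 to congruence of integer coefficients.

open import Data.Integer.Base using (_-_; _*_)
open ℤ[t] using (t; 1#; _⊕_; _⊗_; _^_)

theorem1p4 : (γ : ℕ → ℤ) → IsGamma γ →
    ∀ n → ∃₂ λ (γₙ γ₂ₙ : ℕ) →
    (γ n ≡ + γₙ) ×
    (+ n - γ n ≡ + 2 * + γ₂ₙ) ×
    (χ n ≡ (t ⊕ 1#) ^ γₙ ⊗ (t ^ 2 ⊕ t ⊕ 1#) ^ γ₂ₙ [mod + 2 ])
theorem1p4 γ isGamma n = g , h , γ≡g , n-γ≡2h , λ i → ≡₂⇒∣ (χ≈product .at i)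
  where
  open Modulo2
  open CommutativeRing ℤ₂[t] using (trans; reflexive)
  n≤2^n : ∀ n → n ℕ.≤ 2 ℕ.^ n
  n≤2^n zero    = ℕ.z≤n
  n≤2^n (suc n) = ℕₚ.+-mono-≤ (ℕₚ.m^n>0 2 n) (≡.subst (n ℕ.≤_) (≡.sym (ℕₚ.+-identityʳ _)) (n≤2^n n))
  open Factorisation (factorisation isGamma n n (n≤2^n n))
  n-γ≡2h : + n - γ n ≡ + 2 * + h
  n-γ≡2h = ≡R.begin
    + n - γ n                         ≡R.≡⟨ ≡.cong₂ (λ x y → + x - y) (≡.sym size) γ≡g ⟩
    (+ g ℤ.+ + (2 ℕ.* h)) - + g       ≡R.≡⟨ solve 2 (λ g h → (g :+ h) :- g := h) ≡.refl (+ g) (+ (2 ℕ.* h)) ⟩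
    + (2 ℕ.* h)                       ≡R.≡⟨ ℤₚ.pos-* 2 h ⟩
    + 2 * + h                         ≡R.∎
    where
    module ≡R = ≡.≡-Reasoning
    open ℤSolver.+-*-Solver
  χ≈product : χ n ≈ₚ (t ⊕ 1#) ^ g ⊗ (t ^ 2 ⊕ t ⊕ 1#) ^ h
  χ≈product = trans χ≈u (reflexive (≡.sym (≡.cong₂ _⊗_ (^≡^ a g) (^≡^ b h))))
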